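{- Let $\mathcal P$ be a Datalog program with negation, viewed as a program over Belnap's bilattice $\mathcal{FOUR}$ whose rules have the form $A\leftarrow (L_{1,1}\wedge\dots\wedge L_{1,n_1})\vee\dots\vee(L_{k,1}\wedge\dots\wedge L_{k,n_k})$ with the $L_{p,q}$ ground literals. (1) If $H_{\mathcal F}$ is the everywhere false hypothesis ($H_{\mathcal F}(A)=\mathcal F$ for all $A$), then $sem^{H_{\mathcal F}}_{\mathcal P}$ coincides with the well-founded semantics of $\mathcal P$. (2) If $H_{\mathcal U}$ is the everywhere underdefined hypothesis ($H_{\mathcal U}(A)=\mathcal U$ for all $A$), then $sem^{H_{\mathcal U}}_{\mathcal P}$ coincides with the Kripke–Kleene semantics of $\mathcal P$.
   Context: $\mathcal{FOUR}=\{\mathcal F,\mathcal T,\mathcal U,\mathcal O\}$ with knowledge order $\mathcal U\le_k\mathcal F,\mathcal T\le_k\mathcal O$ and truth order $\mathcal F\le_t\mathcal U,\mathcal O\le_t\mathcal T$; $\wedge,\vee$ are meet/join for $\le_t$, $\otimes,\oplus$ meet/join for $\le_k$; $\neg\mathcal T=\mathcal F$, $\neg\mathcal F=\mathcal T$, $\neg\mathcal U=\mathcal U$, $\neg\mathcal O=\mathcal O$. A program $\mathcal P=\langle F,R\rangle$ consists of a function $F:\mathcal{HB}_{\mathcal P}\to\mathcal{FOUR}$ (the facts) and a finite set $R$ of ground clauses $A\leftarrow B$, each ground atom the head of at most one clause; $Head$ is the set of heads. An interpretation is a function $\mathcal{HB}_{\mathcal P}\to\mathcal{FOUR}$, extended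 to formulas by $I(\neg A)=\neg I(A)$, $I(X\wedge Y)=I(X)\wedge I(Y)$, $I(X\vee Y)=I(X)\vee I(Y)$. Operations on interpretations are pointwise. $I,J$ are compatible if $I(A)\neq\mathcal U\neq J(A)$ implies $I(A)=J(A)$; $I\le J$ means $I(A)\neq\mathcal U\Rightarrow I(A)=J(A)$ for all $A$. $B\equiv_I\alpha$ means $J(B)=\alpha$ for all $J$ with $I\le J$. $T_R(I)(A)=\alpha$ if there is a clause $A\leftarrow B$ in $R$ with $B\equiv_I\alpha$, and $\mathcal U$ otherwise. For a program $\mathcal Q=\langle G,R\rangle$ and hypothesis $H$, $H'$ is sound w.r.t. $\mathcal Q$ if $G,H'$ are compatible and $H'_{/Head}\le T_R(G\oplus H')$ (where $I_{/S}$ is $I$ on $S$ and $\mathcal U$ elsewhere); the support $s^H_{\mathcal Q}$ is the maximal (w.r.t. $\le$) sound $H'\le H$. The $H$-founded semantics $sem^H_{\mathcal P}$ is the limit of the $\le$-increasing sequence $F_0=F$, $F_{n+1}=T_R(F_n)\oplus s^H_{\langle F_n,R\rangle}$. Interpretations with values in $\{\mathcal F,\mathcal T,\mathcal U\}$ are identified with partial interpretations (consistent sets of ground literals) via $I\mapsto\{A\mid I(A)=\mathcal T\}\cup\{\neg A\mid I(A)=\mathcal F\}$. Well-founded semantics (Van Gelder–Ross–Schlipf): for a partial interpretation $I$, $T_P(I)$ is the set of heads of rules all of whose body literals are in $I$; a set $U$ of ground atoms is unfounded w.r.t. $I$ if for every $A\in U$ and every rule with head $A$, some body literal $B$ has $\neg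 B\in I$ or $B\in U$; $U_P(I)$ is the greatest unfounded set; the well-founded semantics is the least fixpoint of $W_P(I)=T_P(I)\cup\neg U_P(I)$. Kripke–Kleene semantics (Fitting): $\Phi_{\mathcal P}(v)(A)=\mathcal T$ if there is a rule with head $A$ whose body is true under $v$; $=\mathcal F$ if there is a rule with head $A$ and all rules with head $A$ have body false under $v$; $=\mathcal U$ otherwise (three-valued Kleene evaluation); the Kripke–Kleene semantics is the fixpoint of $\Phi_{\mathcal P}$ obtained by iterating from the everywhere-$\mathcal U$ valuation (its $\le_k$-least fixpoint).
   Formalization: Each Datalog fact is given the value T in F and is also kept in R as a clause with an empty (true) conjunction; with facts in F only, F_{n+1}=T_R(F_n)⊕s loses them (e.g. F(a)=T, R={b←a}), the sequence is not increasing, and the claim fails. -}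

module Defs where

open import Data.Bool.Base using (if_then_else_)
open import Data.Fin.Base using (Fin; zero; suc; finToFun; funToFin)
open import Data.Fin.Properties as Fin using (finToFun-funToFin)
open import Data.List.Base using (List; []; _∷_; map; filter; deduplicate; any; null)
open import Data.List.Properties using (map-∘; map-id)
open import Data.List.Membership.Propositional using (_∈_)
open import Data.List.Relation.Unary.All as All using (All)
open import Data.List.Relation.Unary.Any as Any using (Any)
open import Data.List.Relation.Unary.Unique.Propositional using (Unique)
open import Data.Nat.Base using (ℕ; zero; suc; _^_)
open import Data.Nat.GeneralisedArithmetic using (fold)
open import Data.Product.Base using (∃; _×_; _,_)
open import Data.Sum.Base using (_⊎_)
open import Function.Base using (_∘_)
open import Level using (0ℓ) renaming (suc to lsuc)
open import Relation.Binary.Core using (Rel)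
open import Relation.Binary.Definitions using (DecidableEquality)
open import Relation.Binary.Lattice.Structures using (IsLattice)
open import Relation.Binary.PropositionalEquality
open import Relation.Nullary.Decidable
  using (Dec; yes; no; does; map′; ¬?; _×-dec_; _⊎-dec_; _→-dec_; from-yes)
open import Relation.Nullary.Negation using (¬_)
open import Relation.Unary using (Pred; Decidable; _≐_) renaming (_⊆_ to _⊆′_)

import Data.List.Membership.DecPropositional as DecMembership
import Data.List.Relation.Unary.Unique.DecPropositional.Properties as UniqueDec

private variable
  n : ℕ

------------------------------------------------------------------------
-- Belnap's bilattice

data FOUR : Set where
  𝓕 𝓣 𝓤 𝓞 : FOUR

toFin : FOUR → Fin 4
toFin 𝓕 = zero
toFin 𝓣 = suc zero
toFin 𝓤 = suc (suc zero)
toFin 𝓞 = suc (suc (suc zero))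

fromFin : Fin 4 → FOUR
fromFin zero                   = 𝓕
fromFin (suc zero)             = 𝓣
fromFin (suc (suc zero))       = 𝓤
fromFin (suc (suc (suc zero))) = 𝓞

fromFin-toFin : ∀ x → fromFin (toFin x) ≡ x
fromFin-toFin 𝓕 = refl
fromFin-toFin 𝓣 = refl
fromFin-toFin 𝓤 = refl
fromFin-toFin 𝓞 = refl

infix 4 _≟_
_≟_ : DecidableEquality FOUR
x ≟ y = map′ (λ e → trans (sym (fromFin-toFin x)) (trans (cong fromFin e) (fromFin-toFin y)))
             (cong toFin) (toFin x Fin.≟ toFin y)

infix 4 _≤ₖ_ _≤ₜ_
_≤ₖ_ _≤ₜ_ : Rel FOUR 0ℓ
x ≤ₖ y = x ≡ 𝓤 ⊎ x ≡ y ⊎ y ≡ 𝓞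
x ≤ₜ y = x ≡ 𝓕 ⊎ x ≡ y ⊎ y ≡ 𝓣

infixr 7 _∧_ _⊗_
infixr 6 _∨_ _⊕_

_∧_ _∨_ _⊗_ _⊕_ : FOUR → FOUR → FOUR

𝓕 ∧ y = 𝓕
𝓣 ∧ y = y
𝓤 ∧ 𝓕 = 𝓕
𝓤 ∧ 𝓣 = 𝓤
𝓤 ∧ 𝓤 = 𝓤
𝓤 ∧ 𝓞 = 𝓕
𝓞 ∧ 𝓕 = 𝓕
𝓞 ∧ 𝓣 = 𝓞
𝓞 ∧ 𝓤 = 𝓕
𝓞 ∧ 𝓞 = 𝓞

𝓕 ∨ y = y
𝓣 ∨ y = 𝓣
𝓤 ∨ 𝓕 = 𝓤
𝓤 ∨ 𝓣 = 𝓣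
𝓤 ∨ 𝓤 = 𝓤
𝓤 ∨ 𝓞 = 𝓣
𝓞 ∨ 𝓕 = 𝓞
𝓞 ∨ 𝓣 = 𝓣
𝓞 ∨ 𝓤 = 𝓣
𝓞 ∨ 𝓞 = 𝓞

𝓤 ⊗ y = 𝓤
𝓞 ⊗ y = y
𝓕 ⊗ 𝓕 = 𝓕
𝓕 ⊗ 𝓣 = 𝓤
𝓕 ⊗ 𝓤 = 𝓤
𝓕 ⊗ 𝓞 = 𝓕
𝓣 ⊗ 𝓕 = 𝓤
𝓣 ⊗ 𝓣 = 𝓣
𝓣 ⊗ 𝓤 = 𝓤
𝓣 ⊗ 𝓞 = 𝓣

𝓤 ⊕ y = y
𝓞 ⊕ y = 𝓞
𝓕 ⊕ 𝓕 = 𝓕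
𝓕 ⊕ 𝓣 = 𝓞
𝓕 ⊕ 𝓤 = 𝓕
𝓕 ⊕ 𝓞 = 𝓞
𝓣 ⊕ 𝓕 = 𝓞
𝓣 ⊕ 𝓣 = 𝓣
𝓣 ⊕ 𝓤 = 𝓣
𝓣 ⊕ 𝓞 = 𝓞

infix 8 ¬₄_
¬₄_ : FOUR → FOUR
¬₄ 𝓕 = 𝓣
¬₄ 𝓣 = 𝓕
¬₄ 𝓤 = 𝓤
¬₄ 𝓞 = 𝓞

private
  ∀? : {P : Pred FOUR 0ℓ} → Decidable P → Dec (∀ x → P x)
  ∀? P? = map′ (λ { (f , t , u , o) → λ { 𝓕 → f ; 𝓣 → t ; 𝓤 → u ; 𝓞 → o } })
               (λ p → p 𝓕 , p 𝓣 , p 𝓤 , p 𝓞)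
               (P? 𝓕 ×-dec P? 𝓣 ×-dec P? 𝓤 ×-dec P? 𝓞)

  _≤ₖ?_ : ∀ x y → Dec (x ≤ₖ y)
  x ≤ₖ? y = x ≟ 𝓤 ⊎-dec x ≟ y ⊎-dec y ≟ 𝓞

  _≤ₜ?_ : ∀ x y → Dec (x ≤ₜ y)
  x ≤ₜ? y = x ≟ 𝓕 ⊎-dec x ≟ y ⊎-dec y ≟ 𝓣

  module Check (_≤_ : Rel FOUR 0ℓ) (_≤?_ : ∀ x y → Dec (x ≤ y)) where
    trans? : Dec (∀ x y z → x ≤ y → y ≤ z → x ≤ z)
    trans? = ∀? λ x → ∀? λ y → ∀? λ z → x ≤? y →-dec y ≤? z →-dec x ≤? z

    antisym? : Dec (∀ x y → x ≤ y → y ≤ x → x ≡ y)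
    antisym? = ∀? λ x → ∀? λ y → x ≤? y →-dec y ≤? x →-dec x ≟ y

    sup? : (_⊔_ : FOUR → FOUR → FOUR) →
           Dec (∀ x y → x ≤ (x ⊔ y) × y ≤ (x ⊔ y) × ∀ z → x ≤ z → y ≤ z → (x ⊔ y) ≤ z)
    sup? _⊔_ = ∀? λ x → ∀? λ y → x ≤? (x ⊔ y) ×-dec y ≤? (x ⊔ y) ×-dec
               ∀? λ z → x ≤? z →-dec y ≤? z →-dec (x ⊔ y) ≤? z

    inf? : (_⊓_ : FOUR → FOUR → FOUR) →
           Dec (∀ x y → (x ⊓ y) ≤ x × (x ⊓ y) ≤ y × ∀ z → z ≤ x → z ≤ y → z ≤ (x ⊓ y))
    inf? _⊓_ = ∀? λ x → ∀? λ y → (x ⊓ y) ≤? x ×-dec (x ⊓ y) ≤? y ×-dec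
               ∀? λ z → z ≤? x →-dec z ≤? y →-dec z ≤? (x ⊓ y)

  module K = Check _≤ₖ_ _≤ₖ?_
  module T = Check _≤ₜ_ _≤ₜ?_

knowledge-isLattice : IsLattice _≡_ _≤ₖ_ _⊕_ _⊗_
knowledge-isLattice = record
  { isPartialOrder = record
    { isPreorder = record
      { isEquivalence = isEquivalence
      ; reflexive     = λ e → _⊎_.inj₂ (_⊎_.inj₁ e)
      ; trans         = λ {x} {y} {z} → from-yes K.trans? x y z
      }
    ; antisym = λ {x} {y} → from-yes K.antisym? x y
    }
  ; supremum = from-yes (K.sup? _⊕_)
  ; infimum  = from-yes (K.inf? _⊗_)
  }

truth-isLattice : IsLattice _≡_ _≤ₜ_ _∨_ _∧_
truth-isLattice = record
  { isPartialOrder = record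
    { isPreorder = record
      { isEquivalence = isEquivalence
      ; reflexive     = λ e → _⊎_.inj₂ (_⊎_.inj₁ e)
      ; trans         = λ {x} {y} {z} → from-yes T.trans? x y z
      }
    ; antisym = λ {x} {y} → from-yes T.antisym? x y
    }
  ; supremum = from-yes (T.sup? _∨_)
  ; infimum  = from-yes (T.inf? _∧_)
  }

------------------------------------------------------------------------
-- Programs over FOUR

-- A Datalog program has finitely many predicates and constants and no
-- function symbols, so its Herbrand base is finite: the ground atoms are
-- the elements of Fin n, for an arbitrary n.

Atom : ℕ → Set
Atom = Fin

data Formula (n : ℕ) : Set where
  atom  : Atom n → Formula n
  const : FOUR → Formula n
  not_  : Formula n → Formula n
  _and_ : Formula n → Formula n → Formula n
  _or_  : Formula n → Formula n → Formula n

infixr 3 _⟵_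
record Rule (n : ℕ) (Body : Set) : Set where
  constructor _⟵_
  field
    head : Atom n
    body : Body
open Rule public

Clause : ℕ → Set
Clause n = Rule n (Formula n)

Interp : ℕ → Set
Interp n = Atom n → FOUR

everywhere : FOUR → Interp n
everywhere α _ = α

_⊕ᴵ_ : Interp n → Interp n → Interp n
(I ⊕ᴵ J) A = I A ⊕ J A

record Program (n : ℕ) : Set where
  field
    facts        : Interp n
    rules        : List (Clause n)
    unique-heads : Unique (map head rules)
open Program public

eval : Interp n → Formula n → FOUR
eval I (atom A)  = I A
eval I (const α) = α
eval I (not X)   = ¬₄ eval I X
eval I (X and Y) = eval I X ∧ eval I Y
eval I (X or Y)  = eval I X ∨ eval I Y

eval-cong : {I J : Interp n} → I ≗ J → ∀ X → eval I X ≡ eval J X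
eval-cong e (atom A)  = e A
eval-cong e (const α) = refl
eval-cong e (not X)   = cong ¬₄_ (eval-cong e X)
eval-cong e (X and Y) = cong₂ _∧_ (eval-cong e X) (eval-cong e Y)
eval-cong e (X or Y)  = cong₂ _∨_ (eval-cong e X) (eval-cong e Y)

Compatible : Rel (Interp n) 0ℓ
Compatible I J = ∀ A → I A ≢ 𝓤 → J A ≢ 𝓤 → I A ≡ J A

infix 4 _≼_ _≼?_
_≼_ : Rel (Interp n) 0ℓ
I ≼ J = ∀ A → I A ≢ 𝓤 → I A ≡ J A

_≼?_ : (I J : Interp n) → Dec (I ≼ J)
I ≼? J = Fin.all? λ A → ¬? (I A ≟ 𝓤) →-dec I A ≟ J A

infix 4 _≡[_]_ _≡[_]?_
_≡[_]_ : Formula n → Interp n → FOUR → Set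
B ≡[ I ] α = ∀ J → I ≼ J → eval J B ≡ α

-- Decided by running through all 4 ^ n interpretations.
_≡[_]?_ : (B : Formula n) (I : Interp n) (α : FOUR) → Dec (B ≡[ I ] α)
_≡[_]?_ {n} B I α =
  map′ to (λ h k → h (decode k))
    (Fin.all? λ k → I ≼? decode k →-dec eval (decode k) B ≟ α)
  where
  decode : Fin (4 ^ n) → Interp n
  decode k = fromFin ∘ finToFun {4} {n} k

  encode : Interp n → Fin (4 ^ n)
  encode J = funToFin (toFin ∘ J)

  decode-encode : ∀ J → decode (encode J) ≗ J
  decode-encode J A =
    trans (cong fromFin (finToFun-funToFin (toFin ∘ J) A)) (fromFin-toFin (J A))

  to : (∀ k → I ≼ decode k → eval (decode k) B ≡ α) → B ≡[ I ] α
  to h J I≼J = trans (sym (eval-cong (decode-encode J) B))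
    (h (encode J) λ A ne → trans (I≼J A ne) (sym (decode-encode J A)))

Derives : List (Clause n) → Interp n → Atom n → FOUR → Set
Derives R I A α = Any (λ c → head c ≡ A × body c ≡[ I ] α) R

derives? : ∀ (R : List (Clause n)) I A α → Dec (Derives R I A α)
derives? R I A α = Any.any? (λ c → head c Fin.≟ A ×-dec (body c ≡[ I ]? α)) R

-- Taking J = I in _≡[_]_ shows that a clause derives at most one value, so
-- with unique heads the order of the tests is irrelevant.
T[_] : List (Clause n) → Interp n → Interp n
T[ R ] I A =
  if does (derives? R I A 𝓣) then 𝓣 else
  if does (derives? R I A 𝓕) then 𝓕 else
  if does (derives? R I A 𝓞) then 𝓞 else 𝓤

_/_ : Interp n → List (Atom n) → Interp n
(I / S) A = if does (A ∈? S) then I A else 𝓤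
  where open DecMembership Fin._≟_ using (_∈?_)

------------------------------------------------------------------------
-- H-founded semantics

record Sound (G : Interp n) (R : List (Clause n)) (H : Interp n) : Set where
  field
    compatible : Compatible G H
    justified  : (H / map head R) ≼ T[ R ] (G ⊕ᴵ H)

-- The maximal sound hypothesis below H is the ≼-greatest one.
record IsSupport (G : Interp n) (R : List (Clause n)) (H s : Interp n) : Set where
  field
    below    : s ≼ H
    sound    : Sound G R s
    greatest : ∀ H′ → H′ ≼ H → Sound G R H′ → H′ ≼ s

record IsLimit (F : ℕ → Interp n) (S : Interp n) : Set where
  field
    increasing : ∀ k → F k ≼ F (suc k)
    upper      : ∀ k → F k ≼ S
    least      : ∀ S′ → (∀ k → F k ≼ S′) → S ≼ S′

record IsFoundedSequence (P : Program n) (H : Interp n) (F : ℕ → Interp n) : Set where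
  field
    start : F 0 ≗ facts P
    step  : ∀ k → ∃ λ s → IsSupport (F k) (rules P) H s
                        × F (suc k) ≗ (T[ rules P ] (F k) ⊕ᴵ s)

-- IsFoundedSemantics P H S : the H-founded semantics of P is S.
IsFoundedSemantics : Program n → Interp n → Interp n → Set
IsFoundedSemantics P H S = ∃ λ F → IsFoundedSequence P H F × IsLimit F S

------------------------------------------------------------------------
-- Datalog programs with negation

data Literal (n : ℕ) : Set where
  pos neg : Atom n → Literal n

complement : Literal n → Literal n
complement (pos A) = neg A
complement (neg A) = pos A

-- Ground rules A ← L₁, …, Lₘ; those with m = 0 are the facts.
Datalog : ℕ → Set
Datalog n = List (Rule n (List (Literal n)))

bodies : Datalog n → Atom n → List (List (Literal n))
bodies P A = map body (filter (λ r → head r Fin.≟ A) P)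

literal : Literal n → Formula n
literal (pos A) = atom A
literal (neg A) = not atom A

⋀ ⋁ : List (Formula n) → Formula n
⋀ []               = const 𝓣
⋀ (X ∷ [])         = X
⋀ (X ∷ Xs@(_ ∷ _)) = X and ⋀ Xs
⋁ []               = const 𝓕
⋁ (X ∷ [])         = X
⋁ (X ∷ Xs@(_ ∷ _)) = X or ⋁ Xs

conjunction : List (Literal n) → Formula n
conjunction Ls = ⋀ (map literal Ls)

-- The rules with a common head are merged into one clause, so ⋁ is never
-- applied to [] here.  The facts also stay among the clauses, as empty
-- conjunctions: the founded sequence has T[ R ] (F k), not F 0, as its
-- first summand, and would lose a fact that no clause rederives.
merge : Datalog n → Atom n → Clause n
merge P A = A ⟵ ⋁ (map conjunction (bodies P A))

heads : Datalog n → List (Atom n)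
heads P = deduplicate Fin._≟_ (map head P)

asProgram : Datalog n → Program n
asProgram P = record
  { facts        = λ A → if any null (bodies P A) then 𝓣 else 𝓤
  ; rules        = map (merge P) (heads P)
  ; unique-heads = subst Unique (sym (trans (sym (map-∘ (heads P))) (map-id (heads P))))
                     (UniqueDec.deduplicate-! Fin._≟_ (map head P))
  }

ThreeValued : Interp n → Set
ThreeValued I = ∀ A → I A ≢ 𝓞

------------------------------------------------------------------------
-- Well-founded semantics

record PartialInterp (n : ℕ) : Set₁ where
  field
    literals   : Pred (Literal n) 0ℓ
    consistent : ∀ A → ¬ (literals (pos A) × literals (neg A))
open PartialInterp public

toPartial : Interp n → PartialInterp n
toPartial I = record
  { literals   = λ { (pos A) → I A ≡ 𝓣 ; (neg A) → I A ≡ 𝓕 }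
  ; consistent = λ { A (t , f) → case-𝓣𝓕 (trans (sym t) f) }
  }
  where
  case-𝓣𝓕 : 𝓣 ≢ 𝓕
  case-𝓣𝓕 ()

Consequences : Datalog n → PartialInterp n → Pred (Atom n) 0ℓ
Consequences P I A = Any (λ r → head r ≡ A × All (literals I) (body r)) P

Positively : Pred (Atom n) 0ℓ → Pred (Literal n) 0ℓ
Positively U L = ∃ λ A → L ≡ pos A × U A

Unfounded : Datalog n → PartialInterp n → Pred (Atom n) 0ℓ → Set
Unfounded P I U = ∀ {A} → U A → ∀ {r} → r ∈ P → head r ≡ A →
  Any (λ L → literals I (complement L) ⊎ Positively U L) (body r)

record IsGreatestUnfounded (P : Datalog n) (I : PartialInterp n)
                           (U : Pred (Atom n) 0ℓ) : Set₁ where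
  field
    unfounded : Unfounded P I U
    greatest  : ∀ V → Unfounded P I V → V ⊆′ U

_∪¬_ : Pred (Atom n) 0ℓ → Pred (Atom n) 0ℓ → Pred (Literal n) 0ℓ
(T ∪¬ U) (pos A) = T A
(T ∪¬ U) (neg A) = U A

-- W P I J : J = T_P(I) ∪ ¬ U_P(I).
W : Datalog n → Rel (PartialInterp n) (lsuc 0ℓ)
W P I J = ∃ λ U → IsGreatestUnfounded P I U × literals J ≐ (Consequences P I ∪¬ U)

record IsLeastFixpointW (P : Datalog n) (I : PartialInterp n) : Set₁ where
  field
    fixpoint : W P I I
    least    : ∀ J → W P J J → literals I ⊆′ literals J

IsWellFounded : Datalog n → Interp n → Set₁
IsWellFounded P S = ThreeValued S × IsLeastFixpointW P (toPartial S)

------------------------------------------------------------------------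
-- Kripke–Kleene semantics

-- On 𝓕, 𝓣, 𝓤 the operations of FOUR are Kleene's.
kleene : Interp n → List (List (Literal n)) → FOUR
kleene v []         = 𝓤
kleene v bs@(_ ∷ _) =
  if does (Any.any? (λ b → eval v (conjunction b) ≟ 𝓣) bs) then 𝓣 else
  if does (All.all? (λ b → eval v (conjunction b) ≟ 𝓕) bs) then 𝓕 else 𝓤

Φ : Datalog n → Interp n → Interp n
Φ P v A = kleene v (bodies P A)

-- Φ is monotone for ≤ₖ and the Herbrand base is finite, so the iteration
-- closes after finitely many steps.
record IsKripkeKleene (P : Datalog n) (S : Interp n) : Set where
  field
    three-valued : ThreeValued S
    iterated     : ∃ λ k → S ≗ fold (everywhere 𝓤) (Φ P) k
    fixpoint     : Φ P S ≗ S
    least        : ∀ v → ThreeValued v → Φ P v ≗ v → ∀ A → S A ≤ₖ v A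

{-# OPTIONS --safe #-}
-- On three-valued interpretations a formula without the constant 𝓞 that has a
-- definite value keeps it in every extension, so T_R agrees with Fitting's Φ.
-- For H_𝓤 the support is empty and the founded sequence is the iteration of Φ
-- with the first step, which yields exactly the facts, cut off.
-- For H_𝓕 the support is the greatest unfounded set, so each step is a step of
-- W_P; it covers the false values of Φ, since an atom all of whose bodies are
-- false forms an unfounded set by itself.  No value 𝓞 arises, because an
-- unfounded set w.r.t. any extension of a stage avoids the true atoms of the
-- stage: the rule deriving such an atom would lead to another one at an earlier
-- stage.
module Submission where

open import Defs
open import Data.Bool.Base using (true; false; if_then_else_)
open import Data.Bool.ListAction using (any)
open import Data.Fin.Base using (Fin)
open import Data.Fin.Properties as Fin using (¬∀⟶∃¬)
open import Data.Fin.Subset using (Subset; _⊂_) renaming (_∈_ to _∈ˢ_)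
open import Data.Fin.Subset.Induction using (⊂-wellFounded; Acc; acc)
open import Data.Fin.Subset.Properties using (anySubset?) renaming (_∈?_ to _∈ˢ?_)
open import Data.List.Base using (List; []; _∷_; map; null)
open import Data.List.Properties using (map-∘; map-id)
open import Data.List.Membership.Propositional using (_∈_; _∉_; lose; find)
open import Data.List.Membership.Propositional.Properties
  using (∈-map⁺; ∈-map⁻; ∈-map∘filter⁺; ∈-map∘filter⁻; ∈-deduplicate⁺; ∈-deduplicate⁻)
open import Data.List.Relation.Unary.All as All using (All; []; _∷_)
open import Data.List.Relation.Unary.All.Properties as All using ()
open import Data.List.Relation.Unary.Any as Any using (Any; here; there)
open import Data.List.Relation.Unary.Any.Properties as Any using ()
open import Data.Nat.Base using (ℕ; zero; suc; _+_)
open import Data.Nat.Properties using (+-comm)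
open import Data.Nat.GeneralisedArithmetic using (fold)
open import Data.Product.Base using (∃; _×_; _,_; proj₁; proj₂)
open import Data.Sum.Base as Sum using (_⊎_; inj₁; inj₂)
open import Data.Vec.Base using (tabulate)
open import Data.Vec.Properties using (lookup∘tabulate; lookup⇒[]=; []=⇒lookup)
open import Effect.Monad using (RawMonad)
open import Function.Base using (_∘_; id)
open import Function.Bundles using (_⇔_; mk⇔; Equivalence)
open import Level using (Level; 0ℓ)
open import Relation.Binary.Lattice.Structures using (IsLattice)
open import Relation.Binary.PropositionalEquality hiding (J)
open import Relation.Nullary.Decidable
  using (Dec; yes; no; does; map′; dec-true; does-⇔; decidable-stable; ¬¬-excluded-middle;
         _×-dec_; _⊎-dec_; _→-dec_)
open import Relation.Nullary.Negation using (¬_; contradiction; ¬¬-Monad)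
open import Relation.Unary using (Pred; Decidable; _≐_) renaming (_⊆_ to _⊆′_)

import Data.List.Membership.DecPropositional as DecMembership

open Equivalence using (to; from)

private variable
  ℓ : Level
  n : ℕ
  I J : Interp n

-- Truth tables of FOUR

¬-≢𝓞 : ∀ {x} → x ≢ 𝓞 → ¬₄ x ≢ 𝓞
¬-≢𝓞 {𝓞} x≢𝓞 _ = x≢𝓞 refl

¬-𝓣 : ∀ {x} → ¬₄ x ≡ 𝓣 ⇔ x ≡ 𝓕
¬-𝓣 {𝓕} = mk⇔ (λ _ → refl) (λ _ → refl)
¬-𝓣 {𝓣} = mk⇔ (λ ()) (λ ())
¬-𝓣 {𝓤} = mk⇔ (λ ()) (λ ())
¬-𝓣 {𝓞} = mk⇔ (λ ()) (λ ())

¬-𝓕 : ∀ {x} → ¬₄ x ≡ 𝓕 ⇔ x ≡ 𝓣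
¬-𝓕 {𝓕} = mk⇔ (λ ()) (λ ())
¬-𝓕 {𝓣} = mk⇔ (λ _ → refl) (λ _ → refl)
¬-𝓕 {𝓤} = mk⇔ (λ ()) (λ ())
¬-𝓕 {𝓞} = mk⇔ (λ ()) (λ ())

∧-identityʳ : ∀ x → x ∧ 𝓣 ≡ x
∧-identityʳ 𝓕 = refl
∧-identityʳ 𝓣 = refl
∧-identityʳ 𝓤 = refl
∧-identityʳ 𝓞 = refl

∧-zeroʳ : ∀ x → x ∧ 𝓕 ≡ 𝓕
∧-zeroʳ 𝓕 = refl
∧-zeroʳ 𝓣 = refl
∧-zeroʳ 𝓤 = refl
∧-zeroʳ 𝓞 = refl

∨-identityʳ : ∀ x → x ∨ 𝓕 ≡ x
∨-identityʳ 𝓕 = refl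
∨-identityʳ 𝓣 = refl
∨-identityʳ 𝓤 = refl
∨-identityʳ 𝓞 = refl

∨-zeroʳ : ∀ x → x ∨ 𝓣 ≡ 𝓣
∨-zeroʳ 𝓕 = refl
∨-zeroʳ 𝓣 = refl
∨-zeroʳ 𝓤 = refl
∨-zeroʳ 𝓞 = refl

∧-≢𝓞 : ∀ {x y} → x ≢ 𝓞 → y ≢ 𝓞 → x ∧ y ≢ 𝓞
∧-≢𝓞 {𝓣} _ y≢𝓞 = y≢𝓞
∧-≢𝓞 {𝓤} {𝓕} _ _ ()
∧-≢𝓞 {𝓤} {𝓣} _ _ ()
∧-≢𝓞 {𝓤} {𝓤} _ _ ()
∧-≢𝓞 {𝓞} x≢𝓞 _ _ = x≢𝓞 refl

∨-≢𝓞 : ∀ {x y} → x ≢ 𝓞 → y ≢ 𝓞 → x ∨ y ≢ 𝓞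
∨-≢𝓞 {𝓕} _ y≢𝓞 = y≢𝓞
∨-≢𝓞 {𝓤} {𝓕} _ _ ()
∨-≢𝓞 {𝓤} {𝓣} _ _ ()
∨-≢𝓞 {𝓤} {𝓤} _ _ ()
∨-≢𝓞 {𝓞} x≢𝓞 _ _ = x≢𝓞 refl

∧-𝓣⁻ : ∀ {x y} → x ∧ y ≡ 𝓣 → x ≡ 𝓣 × y ≡ 𝓣
∧-𝓣⁻ {𝓣} y≡𝓣 = refl , y≡𝓣
∧-𝓣⁻ {𝓤} {𝓕} ()
∧-𝓣⁻ {𝓤} {𝓣} ()
∧-𝓣⁻ {𝓤} {𝓤} ()
∧-𝓣⁻ {𝓤} {𝓞} ()
∧-𝓣⁻ {𝓞} {𝓕} ()
∧-𝓣⁻ {𝓞} {𝓣} ()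
∧-𝓣⁻ {𝓞} {𝓤} ()
∧-𝓣⁻ {𝓞} {𝓞} ()

-- `𝓤 ∧ 𝓞` is `𝓕` although neither conjunct is; excluding `𝓞` removes this case.
∧-𝓕⁻ : ∀ {x y} → x ≢ 𝓞 → y ≢ 𝓞 → x ∧ y ≡ 𝓕 → x ≡ 𝓕 ⊎ y ≡ 𝓕
∧-𝓕⁻ {𝓕} _ _ _ = inj₁ refl
∧-𝓕⁻ {𝓣} _ _ y≡𝓕 = inj₂ y≡𝓕
∧-𝓕⁻ {𝓤} {𝓕} _ _ _ = inj₂ refl
∧-𝓕⁻ {𝓤} {𝓞} _ y≢𝓞 _ = contradiction refl y≢𝓞
∧-𝓕⁻ {𝓞} x≢𝓞 _ _ = contradiction refl x≢𝓞

∨-𝓕⁻ : ∀ {x y} → x ∨ y ≡ 𝓕 → x ≡ 𝓕 × y ≡ 𝓕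
∨-𝓕⁻ {𝓕} y≡𝓕 = refl , y≡𝓕
∨-𝓕⁻ {𝓤} {𝓕} ()
∨-𝓕⁻ {𝓤} {𝓣} ()
∨-𝓕⁻ {𝓤} {𝓤} ()
∨-𝓕⁻ {𝓤} {𝓞} ()
∨-𝓕⁻ {𝓞} {𝓕} ()
∨-𝓕⁻ {𝓞} {𝓣} ()
∨-𝓕⁻ {𝓞} {𝓤} ()
∨-𝓕⁻ {𝓞} {𝓞} ()

∨-𝓣⁻ : ∀ {x y} → x ≢ 𝓞 → y ≢ 𝓞 → x ∨ y ≡ 𝓣 → x ≡ 𝓣 ⊎ y ≡ 𝓣
∨-𝓣⁻ {𝓕} _ _ y≡𝓣 = inj₂ y≡𝓣
∨-𝓣⁻ {𝓣} _ _ _ = inj₁ refl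
∨-𝓣⁻ {𝓤} {𝓣} _ _ _ = inj₂ refl
∨-𝓣⁻ {𝓤} {𝓞} _ y≢𝓞 _ = contradiction refl y≢𝓞
∨-𝓣⁻ {𝓞} x≢𝓞 _ _ = contradiction refl x≢𝓞

⊕-identityʳ : ∀ x → x ⊕ 𝓤 ≡ x
⊕-identityʳ 𝓕 = refl
⊕-identityʳ 𝓣 = refl
⊕-identityʳ 𝓤 = refl
⊕-identityʳ 𝓞 = refl

⊕-idem : ∀ x → x ⊕ x ≡ x
⊕-idem 𝓕 = refl
⊕-idem 𝓣 = refl
⊕-idem 𝓤 = refl
⊕-idem 𝓞 = refl

⊕-comm : ∀ x y → x ⊕ y ≡ y ⊕ x
⊕-comm x y = IsLattice.antisym knowledge-isLattice
  -- The `∨` in the field names stands for the join of the knowledge order, which is `⊕`.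
  (∨-least (y≤x∨y y x) (x≤x∨y y x)) (∨-least (y≤x∨y x y) (x≤x∨y x y))
  where open IsLattice knowledge-isLattice

-- The only knowledge joins with a new value are those of `𝓕` and `𝓣`, and that value is `𝓞`.
⊕-sel : ∀ {x y} → x ⊕ y ≢ 𝓞 → x ⊕ y ≡ x ⊎ x ⊕ y ≡ y
⊕-sel {𝓤}     _ = inj₂ refl
⊕-sel {𝓞}     _ = inj₁ refl
⊕-sel {𝓕} {𝓕} _ = inj₁ refl
⊕-sel {𝓕} {𝓤} _ = inj₁ refl
⊕-sel {𝓕} {𝓣} x⊕y≢𝓞 = contradiction refl x⊕y≢𝓞
⊕-sel {𝓕} {𝓞} _ = inj₂ refl
⊕-sel {𝓣} {𝓣} _ = inj₁ refl
⊕-sel {𝓣} {𝓤} _ = inj₁ refl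
⊕-sel {𝓣} {𝓕} x⊕y≢𝓞 = contradiction refl x⊕y≢𝓞
⊕-sel {𝓣} {𝓞} _ = inj₂ refl

-- The order `≼` at a single atom. It is flat with bottom `𝓤`, so unlike in `≤ₖ`, `𝓣` is not below
-- `𝓞`.
infix 4 _≼₄_
_≼₄_ : FOUR → FOUR → Set
x ≼₄ y = x ≢ 𝓤 → x ≡ y

¬-≼ : ∀ {x x′} → x ≼₄ x′ → ¬₄ x ≼₄ ¬₄ x′
¬-≼ {𝓤} _ ¬x≢𝓤 = contradiction refl ¬x≢𝓤
¬-≼ {𝓕} x≼x′ _ = cong ¬₄_ (x≼x′ λ ())
¬-≼ {𝓣} x≼x′ _ = cong ¬₄_ (x≼x′ λ ())
¬-≼ {𝓞} x≼x′ _ = cong ¬₄_ (x≼x′ λ ())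

-- A definite value of `x ∧ y` is fixed by its definite operands alone, except that `𝓤 ∧ 𝓞 = 𝓕`
-- becomes `𝓞` when `𝓤` is raised to `𝓣`. Dually for `∨`.
∧-≼ : ∀ {x y x′ y′} → x ≢ 𝓞 → y ≢ 𝓞 → x ≼₄ x′ → y ≼₄ y′ → x ∧ y ≼₄ x′ ∧ y′
∧-≼ {𝓕}     _ _ x≼x′ _ _ rewrite sym (x≼x′ λ ()) = refl
∧-≼ {𝓣}     _ _ x≼x′ y≼y′ y≢𝓤 rewrite sym (x≼x′ λ ()) = y≼y′ y≢𝓤
∧-≼ {𝓤} {𝓕} {x′} _ _ _ y≼y′ _ rewrite sym (y≼y′ λ ()) = sym (∧-zeroʳ x′)
∧-≼ {𝓤} {𝓣} _ _ _ _ 𝓤≢𝓤 = contradiction refl 𝓤≢𝓤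
∧-≼ {𝓤} {𝓤} _ _ _ _ 𝓤≢𝓤 = contradiction refl 𝓤≢𝓤
∧-≼ {𝓤} {𝓞} _ y≢𝓞 _ _ _ = contradiction refl y≢𝓞
∧-≼ {𝓞}     x≢𝓞 _ _ _ _ = contradiction refl x≢𝓞

∨-≼ : ∀ {x y x′ y′} → x ≢ 𝓞 → y ≢ 𝓞 → x ≼₄ x′ → y ≼₄ y′ → x ∨ y ≼₄ x′ ∨ y′
∨-≼ {𝓕}     _ _ x≼x′ y≼y′ y≢𝓤 rewrite sym (x≼x′ λ ()) = y≼y′ y≢𝓤
∨-≼ {𝓣}     _ _ x≼x′ _ _ rewrite sym (x≼x′ λ ()) = refl
∨-≼ {𝓤} {𝓣} {x′} _ _ _ y≼y′ _ rewrite sym (y≼y′ λ ()) = sym (∨-zeroʳ x′)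
∨-≼ {𝓤} {𝓕} _ _ _ _ 𝓤≢𝓤 = contradiction refl 𝓤≢𝓤
∨-≼ {𝓤} {𝓤} _ _ _ _ 𝓤≢𝓤 = contradiction refl 𝓤≢𝓤
∨-≼ {𝓤} {𝓞} _ y≢𝓞 _ _ _ = contradiction refl y≢𝓞
∨-≼ {𝓞}     x≢𝓞 _ _ _ _ = contradiction refl x≢𝓞

-- The order `≼` on interpretations

≼-trans : ∀ {I J K : Interp n} → I ≼ J → J ≼ K → I ≼ K
≼-trans I≼J J≼K A IA≢𝓤 =
  trans (I≼J A IA≢𝓤) (J≼K A λ JA≡𝓤 → IA≢𝓤 (trans (I≼J A IA≢𝓤) JA≡𝓤))

≼-reflexive : I ≗ J → I ≼ J
≼-reflexive I≗J A _ = I≗J A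

≼-antisym : I ≼ J → J ≼ I → I ≗ J
≼-antisym {I = I} {J} I≼J J≼I A with I A ≟ 𝓤 | J A ≟ 𝓤
... | no IA≢𝓤  | _          = I≼J A IA≢𝓤
... | yes _    | no JA≢𝓤    = sym (J≼I A JA≢𝓤)
... | yes IA≡𝓤 | yes JA≡𝓤   = trans IA≡𝓤 (sym JA≡𝓤)

≗-sym : I ≗ J → J ≗ I
≗-sym I≗J A = sym (I≗J A)

≗-trans : ∀ {I J K : Interp n} → I ≗ J → J ≗ K → I ≗ K
≗-trans I≗J J≗K A = trans (I≗J A) (J≗K A)

-- Evaluation of formulas

-- Covers all merged bodies: their only constants come from `⋀ []` and `⋁ []`.
data 𝓞-Free {n : ℕ} : Formula n → Set where
  atom  : ∀ A → 𝓞-Free (atom A)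
  const : ∀ {α} → α ≢ 𝓞 → 𝓞-Free (const α)
  not_  : ∀ {X} → 𝓞-Free X → 𝓞-Free (not X)
  _and_ : ∀ {X Y} → 𝓞-Free X → 𝓞-Free Y → 𝓞-Free (X and Y)
  _or_  : ∀ {X Y} → 𝓞-Free X → 𝓞-Free Y → 𝓞-Free (X or Y)

eval-≢𝓞 : ThreeValued I → ∀ {X} → 𝓞-Free X → eval I X ≢ 𝓞
eval-≢𝓞 I₃ (atom A)    = I₃ A
eval-≢𝓞 I₃ (const α≢𝓞) = α≢𝓞
eval-≢𝓞 I₃ (not x)     = ¬-≢𝓞 (eval-≢𝓞 I₃ x)
eval-≢𝓞 I₃ (x and y)   = ∧-≢𝓞 (eval-≢𝓞 I₃ x) (eval-≢𝓞 I₃ y)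
eval-≢𝓞 I₃ (x or y)    = ∨-≢𝓞 (eval-≢𝓞 I₃ x) (eval-≢𝓞 I₃ y)

-- Only `I` is three-valued; `J` may take the value `𝓞`, because `≡[ I ]` quantifies over all
-- four-valued extensions.
eval-≼ : ThreeValued I → I ≼ J → ∀ {X} → 𝓞-Free X → eval I X ≼₄ eval J X
eval-≼ I₃ I≼J (atom A)  = I≼J A
eval-≼ I₃ I≼J (const _) = λ _ → refl
eval-≼ I₃ I≼J (not x)   = ¬-≼ (eval-≼ I₃ I≼J x)
eval-≼ I₃ I≼J (x and y) =
  ∧-≼ (eval-≢𝓞 I₃ x) (eval-≢𝓞 I₃ y) (eval-≼ I₃ I≼J x) (eval-≼ I₃ I≼J y)
eval-≼ I₃ I≼J (x or y)  =
  ∨-≼ (eval-≢𝓞 I₃ x) (eval-≢𝓞 I₃ y) (eval-≼ I₃ I≼J x) (eval-≼ I₃ I≼J y)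

-- One direction takes `J = I`, the other is `eval-≼`. The value `𝓤` is excluded since an extension
-- may change it.
≡[]-eval : ThreeValued I → ∀ {X α} → 𝓞-Free X → α ≢ 𝓤 → X ≡[ I ] α ⇔ eval I X ≡ α
≡[]-eval {I = I} I₃ x α≢𝓤 = mk⇔
  (λ X≡α → X≡α I λ _ _ → refl)
  (λ IX≡α J I≼J →
    trans (sym (eval-≼ I₃ I≼J x λ IX≡𝓤 → α≢𝓤 (trans (sym IX≡α) IX≡𝓤))) IX≡α)

-- The unit law absorbs the separate clause of `⋀` for singletons, so that later inductions have a
-- uniform step.
eval-⋀-∷ : ∀ (I : Interp n) X Xs → eval I (⋀ (X ∷ Xs)) ≡ eval I X ∧ eval I (⋀ Xs)
eval-⋀-∷ I X []      = sym (∧-identityʳ (eval I X))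
eval-⋀-∷ I X (_ ∷ _) = refl

eval-⋁-∷ : ∀ (I : Interp n) X Xs → eval I (⋁ (X ∷ Xs)) ≡ eval I X ∨ eval I (⋁ Xs)
eval-⋁-∷ I X []      = sym (∨-identityʳ (eval I X))
eval-⋁-∷ I X (_ ∷ _) = refl

⋀-𝓞-Free : ∀ {Xs : List (Formula n)} → All 𝓞-Free Xs → 𝓞-Free (⋀ Xs)
⋀-𝓞-Free []             = const λ ()
⋀-𝓞-Free (x ∷ [])       = x
⋀-𝓞-Free (x ∷ xs@(_ ∷ _)) = x and ⋀-𝓞-Free xs

⋁-𝓞-Free : ∀ {Xs : List (Formula n)} → All 𝓞-Free Xs → 𝓞-Free (⋁ Xs)
⋁-𝓞-Free []             = const λ ()
⋁-𝓞-Free (x ∷ [])       = x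
⋁-𝓞-Free (x ∷ xs@(_ ∷ _)) = x or ⋁-𝓞-Free xs

⋀-𝓣 : ∀ {Xs} → eval I (⋀ Xs) ≡ 𝓣 ⇔ All (λ X → eval I X ≡ 𝓣) Xs
⋀-𝓣 {I = I} = mk⇔ ⁻ ⁺
  where
  ⁻ : ∀ {Xs} → eval I (⋀ Xs) ≡ 𝓣 → All (λ X → eval I X ≡ 𝓣) Xs
  ⁻ {[]}     _ = []
  ⁻ {X ∷ Xs} e with p , q ← ∧-𝓣⁻ (trans (sym (eval-⋀-∷ I X Xs)) e) = p ∷ ⁻ q

  ⁺ : ∀ {Xs} → All (λ X → eval I X ≡ 𝓣) Xs → eval I (⋀ Xs) ≡ 𝓣
  ⁺ []                 = refl
  ⁺ {X ∷ Xs} (p ∷ ps) = trans (eval-⋀-∷ I X Xs) (cong₂ _∧_ p (⁺ ps))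

⋀-𝓕 : ThreeValued I → ∀ {Xs} → All 𝓞-Free Xs →
      eval I (⋀ Xs) ≡ 𝓕 ⇔ Any (λ X → eval I X ≡ 𝓕) Xs
⋀-𝓕 {I = I} I₃ xs = mk⇔ (⁻ xs) ⁺
  where
  ⁻ : ∀ {Xs} → All 𝓞-Free Xs → eval I (⋀ Xs) ≡ 𝓕 → Any (λ X → eval I X ≡ 𝓕) Xs
  ⁻ {X ∷ Xs} (x ∷ xs) e
    with ∧-𝓕⁻ (eval-≢𝓞 I₃ x) (eval-≢𝓞 I₃ (⋀-𝓞-Free xs)) (trans (sym (eval-⋀-∷ I X Xs)) e)
  ... | inj₁ p = here p
  ... | inj₂ q = there (⁻ xs q)

  ⁺ : ∀ {Xs} → Any (λ X → eval I X ≡ 𝓕) Xs → eval I (⋀ Xs) ≡ 𝓕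
  ⁺ {X ∷ Xs} (here p)  = trans (eval-⋀-∷ I X Xs) (cong (_∧ _) p)
  ⁺ {X ∷ Xs} (there p) =
    trans (eval-⋀-∷ I X Xs) (trans (cong (eval I X ∧_) (⁺ p)) (∧-zeroʳ (eval I X)))

⋁-𝓕 : ∀ {Xs} → eval I (⋁ Xs) ≡ 𝓕 ⇔ All (λ X → eval I X ≡ 𝓕) Xs
⋁-𝓕 {I = I} = mk⇔ ⁻ ⁺
  where
  ⁻ : ∀ {Xs} → eval I (⋁ Xs) ≡ 𝓕 → All (λ X → eval I X ≡ 𝓕) Xs
  ⁻ {[]}     _ = []
  ⁻ {X ∷ Xs} e with p , q ← ∨-𝓕⁻ (trans (sym (eval-⋁-∷ I X Xs)) e) = p ∷ ⁻ q

  ⁺ : ∀ {Xs} → All (λ X → eval I X ≡ 𝓕) Xs → eval I (⋁ Xs) ≡ 𝓕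
  ⁺ []                 = refl
  ⁺ {X ∷ Xs} (p ∷ ps) = trans (eval-⋁-∷ I X Xs) (cong₂ _∨_ p (⁺ ps))

⋁-𝓣 : ThreeValued I → ∀ {Xs} → All 𝓞-Free Xs →
      eval I (⋁ Xs) ≡ 𝓣 ⇔ Any (λ X → eval I X ≡ 𝓣) Xs
⋁-𝓣 {I = I} I₃ xs = mk⇔ (⁻ xs) ⁺
  where
  ⁻ : ∀ {Xs} → All 𝓞-Free Xs → eval I (⋁ Xs) ≡ 𝓣 → Any (λ X → eval I X ≡ 𝓣) Xs
  ⁻ {X ∷ Xs} (x ∷ xs) e
    with ∨-𝓣⁻ (eval-≢𝓞 I₃ x) (eval-≢𝓞 I₃ (⋁-𝓞-Free xs)) (trans (sym (eval-⋁-∷ I X Xs)) e)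
  ... | inj₁ p = here p
  ... | inj₂ q = there (⁻ xs q)

  ⁺ : ∀ {Xs} → Any (λ X → eval I X ≡ 𝓣) Xs → eval I (⋁ Xs) ≡ 𝓣
  ⁺ {X ∷ Xs} (here p)  = trans (eval-⋁-∷ I X Xs) (cong (_∨ _) p)
  ⁺ {X ∷ Xs} (there p) =
    trans (eval-⋁-∷ I X Xs) (trans (cong (eval I X ∨_) (⁺ p)) (∨-zeroʳ (eval I X)))

literal-𝓞-Free : ∀ (L : Literal n) → 𝓞-Free (literal L)
literal-𝓞-Free (pos A) = atom A
literal-𝓞-Free (neg A) = not atom A

literals-𝓞-Free : ∀ (Ls : List (Literal n)) → All 𝓞-Free (map literal Ls)
literals-𝓞-Free Ls = All.map⁺ (All.universal literal-𝓞-Free Ls)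

conjunctions-𝓞-Free : ∀ (bs : List (List (Literal n))) → All 𝓞-Free (map conjunction bs)
conjunctions-𝓞-Free bs = All.map⁺ (All.universal (⋀-𝓞-Free ∘ literals-𝓞-Free) bs)

body-𝓞-Free : ∀ (P : Datalog n) A → 𝓞-Free (body (merge P A))
body-𝓞-Free P A = ⋁-𝓞-Free (conjunctions-𝓞-Free (bodies P A))

literal-𝓣 : ∀ L → eval I (literal L) ≡ 𝓣 ⇔ literals (toPartial I) L
literal-𝓣 (pos A) = mk⇔ id id
literal-𝓣 (neg A) = ¬-𝓣

literal-𝓕 : ∀ L → eval I (literal L) ≡ 𝓕 ⇔ literals (toPartial I) (complement L)
literal-𝓕 (pos A) = mk⇔ id id
literal-𝓕 (neg A) = ¬-𝓕

conjunction-𝓣 : ∀ {b} → eval I (conjunction b) ≡ 𝓣 ⇔ All (literals (toPartial I)) b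
conjunction-𝓣 = mk⇔
  (All.map (λ {L} → to (literal-𝓣 L)) ∘ All.map⁻ ∘ to ⋀-𝓣)
  (from ⋀-𝓣 ∘ All.map⁺ ∘ All.map (λ {L} → from (literal-𝓣 L)))

-- Brings falsity of a body into the form of the first alternative in `Unfounded`.
conjunction-𝓕 : ThreeValued I → ∀ {b} →
  eval I (conjunction b) ≡ 𝓕 ⇔ Any (literals (toPartial I) ∘ complement) b
conjunction-𝓕 I₃ {b} = mk⇔
  (Any.map (λ {L} → to (literal-𝓕 L)) ∘ Any.map⁻ ∘ to (⋀-𝓕 I₃ (literals-𝓞-Free b)))
  (from (⋀-𝓕 I₃ (literals-𝓞-Free b)) ∘ Any.map⁺ ∘ Any.map (λ {L} → from (literal-𝓕 L)))

-- The operators T_R and Φ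

Heads : Datalog n → List (Atom n)
Heads P = map head P

_∈ᵃ?_ : (A : Atom n) (As : List (Atom n)) → Dec (A ∈ As)
_∈ᵃ?_ = DecMembership._∈?_ Fin._≟_

∈-bodies : ∀ {P : Datalog n} {A b} → b ∈ bodies P A ⇔ (∃ λ r → r ∈ P × b ≡ body r × head r ≡ A)
∈-bodies {A = A} = mk⇔ (∈-map∘filter⁻ body (λ r → head r Fin.≟ A) {f = body})
                       (∈-map∘filter⁺ body (λ r → head r Fin.≟ A) {f = body})

∉Heads⇒bodies≡[] : ∀ {P : Datalog n} {A} → A ∉ Heads P → bodies P A ≡ []
∉Heads⇒bodies≡[] {P = P} {A} A∉ with bodies P A in eq
... | [] = refl
... | b ∷ bs with r , r∈P , _ , refl ← to (∈-bodies {P = P} {A} {b}) (subst (b ∈_) (sym eq) (here refl)) =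
  contradiction (∈-map⁺ head r∈P) A∉

map-head-rules : ∀ (P : Datalog n) → map head (rules (asProgram P)) ≡ heads P
map-head-rules P = trans (sym (map-∘ (heads P))) (map-id (heads P))

∈-heads : ∀ {P : Datalog n} {A} → A ∈ heads P ⇔ A ∈ Heads P
∈-heads {P = P} = mk⇔ (∈-deduplicate⁻ Fin._≟_ (Heads P)) (∈-deduplicate⁺ Fin._≟_)

∈-rules : ∀ {P : Datalog n} {A} → A ∈ map head (rules (asProgram P)) ⇔ A ∈ Heads P
∈-rules {P = P} {A} = mk⇔
  (to ∈-heads ∘ subst (A ∈_) (map-head-rules P))
  (subst (A ∈_) (sym (map-head-rules P)) ∘ from ∈-heads)

derives-merge : ∀ {P : Datalog n} {A α} →
  Derives (rules (asProgram P)) I A α ⇔ (A ∈ Heads P × body (merge P A) ≡[ I ] α)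
derives-merge {I = I} {P} {A} {α} = mk⇔ ⁻ ⁺
  where
  ⁻ : Derives (rules (asProgram P)) I A α → A ∈ Heads P × body (merge P A) ≡[ I ] α
  ⁻ d with B , B∈ , refl , p ← find (Any.map⁻ d) = to ∈-heads B∈ , p

  ⁺ : A ∈ Heads P × body (merge P A) ≡[ I ] α → Derives (rules (asProgram P)) I A α
  ⁺ (A∈ , p) = Any.map⁺ (lose (from (∈-heads {P = P}) A∈) (refl , p))

-- Spares later proofs the nested tests: a successful test identifies `x`, and if all three fail
-- then `x` must be `𝓤`, as any other value would be derived.
T-≡ : ∀ {R : List (Clause n)} {A x} →
      (∀ {α} → α ≢ 𝓤 → Derives R I A α ⇔ x ≡ α) → T[ R ] I A ≡ x
T-≡ {I = I} {R} {A} {x} char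
  with derives? R I A 𝓣 | derives? R I A 𝓕 | derives? R I A 𝓞
... | yes d𝓣 | _      | _      = sym (to (char λ ()) d𝓣)
... | no _   | yes d𝓕 | _      = sym (to (char λ ()) d𝓕)
... | no _   | no _   | yes d𝓞 = sym (to (char λ ()) d𝓞)
... | no ¬𝓣  | no ¬𝓕  | no ¬𝓞  with x ≟ 𝓤
...   | yes x≡𝓤 = sym x≡𝓤
...   | no x≢𝓤  = contradiction (from (char x≢𝓤) refl) (excluded x x≢𝓤)
  where
  excluded : ∀ α → α ≢ 𝓤 → ¬ Derives R I A α
  excluded 𝓕 _ = ¬𝓕
  excluded 𝓣 _ = ¬𝓣
  excluded 𝓤 𝓤≢𝓤 = contradiction refl 𝓤≢𝓤
  excluded 𝓞 _ = ¬𝓞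

derives-cong : ∀ {R : List (Clause n)} {A} → I ≗ J → ∀ α →
               does (derives? R I A α) ≡ does (derives? R J A α)
derives-cong {n = n} {I} {J} {R} {A} I≗J α =
  does-⇔ (mk⇔ (weaken I≗J) (weaken (≗-sym I≗J))) (derives? R I A α) (derives? R J A α)
  where
  weaken : ∀ {K L : Interp n} → K ≗ L → Derives R K A α → Derives R L A α
  weaken K≗L = Any.map λ (A≡ , X≡α) → A≡ , λ M L≼M → X≡α M (≼-trans (≼-reflexive K≗L) L≼M)

T-cong : ∀ (R : List (Clause n)) → I ≗ J → T[ R ] I ≗ T[ R ] J
T-cong R I≗J A
  rewrite derives-cong {R = R} {A} I≗J 𝓣
        | derives-cong {R = R} {A} I≗J 𝓕
        | derives-cong {R = R} {A} I≗J 𝓞 = refl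

if-𝓣-𝓕 : ∀ {D E : Set} {x} (d : Dec D) (e : Dec E) → D ⇔ x ≡ 𝓣 → E ⇔ x ≡ 𝓕 → x ≢ 𝓞 →
          (if does d then 𝓣 else if does e then 𝓕 else 𝓤) ≡ x
if-𝓣-𝓕         (yes d) _       D⇔ E⇔ x≢𝓞 = sym (to D⇔ d)
if-𝓣-𝓕         (no _)  (yes e) D⇔ E⇔ x≢𝓞 = sym (to E⇔ e)
if-𝓣-𝓕 {x = 𝓕} (no _)  (no ¬e) D⇔ E⇔ x≢𝓞 = contradiction (from E⇔ refl) ¬e
if-𝓣-𝓕 {x = 𝓣} (no ¬d) (no _)  D⇔ E⇔ x≢𝓞 = contradiction (from D⇔ refl) ¬d
if-𝓣-𝓕 {x = 𝓤} (no _)  (no _)  D⇔ E⇔ x≢𝓞 = refl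
if-𝓣-𝓕 {x = 𝓞} (no _)  (no _)  D⇔ E⇔ x≢𝓞 = contradiction refl x≢𝓞

-- Stated for nonempty lists: on `[]` the left side is `𝓤` while the empty disjunction is `𝓕`.
kleene-⋁ : ThreeValued I → ∀ b bs →
           kleene I (b ∷ bs) ≡ eval I (⋁ (map conjunction (b ∷ bs)))
kleene-⋁ {I = I} I₃ b bs = if-𝓣-𝓕
  (Any.any? (λ b → eval I (conjunction b) ≟ 𝓣) (b ∷ bs))
  (All.all? (λ b → eval I (conjunction b) ≟ 𝓕) (b ∷ bs))
  (mk⇔ (from (⋁-𝓣 I₃ free) ∘ Any.map⁺) (Any.map⁻ ∘ to (⋁-𝓣 I₃ free)))
  (mk⇔ (from (⋁-𝓕 {Xs = Xs}) ∘ All.map⁺) (All.map⁻ ∘ to (⋁-𝓕 {Xs = Xs})))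
  (eval-≢𝓞 I₃ (⋁-𝓞-Free free))
  where
  Xs = map conjunction (b ∷ bs)
  free = conjunctions-𝓞-Free (b ∷ bs)

Φ-head : ThreeValued I → ∀ {P A} → A ∈ Heads P → Φ P I A ≡ eval I (body (merge P A))
Φ-head I₃ {P} {A} A∈ with bodies P A in eq
... | b ∷ bs = kleene-⋁ I₃ b bs
-- A head has at least one body, so the empty list cannot occur.
... | [] with r , r∈P , refl ← ∈-map⁻ head A∈
         with () ← subst (body r ∈_) eq (from (∈-bodies {P = P}) (r , r∈P , refl , refl))

Φ-non-head : ∀ {P A} → A ∉ Heads P → Φ P I A ≡ 𝓤
Φ-non-head {I = I} {P} A∉ = cong (kleene I) (∉Heads⇒bodies≡[] {P = P} A∉)

-- For a head, `≡[]-eval` turns derivation of a definite value into evaluation of the merged clause;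
-- for any other atom both sides are `𝓤`.
T≗Φ : ∀ P → ThreeValued I → T[ rules (asProgram P) ] I ≗ Φ P I
T≗Φ {I = I} P I₃ A with A ∈ᵃ? Heads P
... | yes A∈ = trans
  (T-≡ λ α≢𝓤 → mk⇔
    (to (≡[]-eval I₃ (body-𝓞-Free P A) α≢𝓤) ∘ proj₂ ∘ to (derives-merge {P = P}))
    (λ e → from (derives-merge {P = P}) (A∈ , from (≡[]-eval I₃ (body-𝓞-Free P A) α≢𝓤) e)))
  (sym (Φ-head I₃ {P} A∈))
... | no A∉ = trans
  (T-≡ λ α≢𝓤 → mk⇔
    (λ d → contradiction (proj₁ (to (derives-merge {P = P}) d)) A∉)
    (λ 𝓤≡α → contradiction (sym 𝓤≡α) α≢𝓤))
  (sym (Φ-non-head {P = P} A∉))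

Φ-≢𝓞 : ∀ P → ThreeValued I → ThreeValued (Φ P I)
Φ-≢𝓞 P I₃ A e with A ∈ᵃ? Heads P
... | yes A∈ = eval-≢𝓞 I₃ (body-𝓞-Free P A) (trans (sym (Φ-head I₃ {P} A∈)) e)
... | no A∉ with () ← trans (sym (Φ-non-head {P = P} A∉)) e

Φ-≼ : ∀ P → ThreeValued I → ThreeValued J → I ≼ J → Φ P I ≼ Φ P J
Φ-≼ P I₃ J₃ I≼J A Φ≢𝓤 with A ∈ᵃ? Heads P
... | yes A∈ = trans (Φ-head I₃ {P} A∈) (trans
  (eval-≼ I₃ I≼J (body-𝓞-Free P A) λ e → Φ≢𝓤 (trans (Φ-head I₃ {P} A∈) e))
  (sym (Φ-head J₃ {P} A∈)))
... | no A∉ = contradiction (Φ-non-head {P = P} A∉) Φ≢𝓤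

Φ-cong : ∀ P → ThreeValued I → I ≗ J → Φ P I ≗ Φ P J
Φ-cong P I₃ I≗J = ≼-antisym (Φ-≼ P I₃ J₃ (≼-reflexive I≗J)) (Φ-≼ P J₃ I₃ (≼-reflexive (≗-sym I≗J)))
  where J₃ = λ A → I₃ A ∘ trans (I≗J A)

-- Identifies the true part of `Φ` with the positive part of `W`.
Φ-𝓣 : ∀ P → ThreeValued I → ∀ {A} → Φ P I A ≡ 𝓣 ⇔ Consequences P (toPartial I) A
Φ-𝓣 {I = I} P I₃ {A} = mk⇔ ⁻ ⁺
  where
  ⁻ : Φ P I A ≡ 𝓣 → Consequences P (toPartial I) A
  ⁻ e with A ∈ᵃ? Heads P
  ... | no A∉ with () ← trans (sym (Φ-non-head {P = P} A∉)) e
  ... | yes A∈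
    with b , b∈ , p ← find (Any.map⁻ (to (⋁-𝓣 I₃ (conjunctions-𝓞-Free (bodies P A)))
                                         (trans (sym (Φ-head I₃ {P} A∈)) e)))
    with r , r∈P , refl , refl ← to (∈-bodies {P = P}) b∈
    = lose r∈P (refl , to conjunction-𝓣 p)

  ⁺ : Consequences P (toPartial I) A → Φ P I A ≡ 𝓣
  ⁺ c with r , r∈P , refl , p ← find c =
    trans (Φ-head I₃ {P} (∈-map⁺ head r∈P))
          (from (⋁-𝓣 I₃ (conjunctions-𝓞-Free (bodies P A)))
                (Any.map⁺ (lose (from (∈-bodies {P = P}) (r , r∈P , refl , refl))
                                (from conjunction-𝓣 p))))

-- The unfoundedness condition at `A` with its first alternative only; it makes the singleton of `A`
-- unfounded.
AllFail : Datalog n → Interp n → Atom n → Set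
AllFail P I A = ∀ {r} → r ∈ P → head r ≡ A → Any (literals (toPartial I) ∘ complement) (body r)

-- Membership in the heads is part of the condition because `AllFail` holds vacuously for an atom
-- without rules, where `Φ` gives `𝓤`.
Φ-𝓕 : ∀ P → ThreeValued I → ∀ {A} → Φ P I A ≡ 𝓕 ⇔ (A ∈ Heads P × AllFail P I A)
Φ-𝓕 {I = I} P I₃ {A} = mk⇔ ⁻ ⁺
  where
  ⁻ : Φ P I A ≡ 𝓕 → A ∈ Heads P × AllFail P I A
  ⁻ e with A ∈ᵃ? Heads P
  ... | no A∉ with () ← trans (sym (Φ-non-head {P = P} A∉)) e
  ... | yes A∈ = A∈ , λ { {r} r∈P refl → to (conjunction-𝓕 I₃)
    (All.lookup (All.map⁻ {xs = bodies P A} (to ⋁-𝓕 (trans (sym (Φ-head I₃ {P} A∈)) e)))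
                (from (∈-bodies {P = P}) (r , r∈P , refl , refl))) }

  fails : AllFail P I A → ∀ {b} → b ∈ bodies P A → eval I (conjunction b) ≡ 𝓕
  fails f b∈ with r , r∈P , refl , h ← to (∈-bodies {P = P}) b∈ =
    from (conjunction-𝓕 I₃) (f r∈P h)

  ⁺ : A ∈ Heads P × AllFail P I A → Φ P I A ≡ 𝓕
  ⁺ (A∈ , f) = trans (Φ-head I₃ {P} A∈)
    (from (⋁-𝓕 {Xs = map conjunction (bodies P A)}) (All.map⁺ (All.tabulate (fails f))))

-- The facts as the first iterate of `Φ`

undefined-conjunction : ∀ (b : List (Literal n)) →
  eval (everywhere 𝓤) (conjunction b) ≡ (if null b then 𝓣 else 𝓤)
undefined-conjunction []           = refl
undefined-conjunction (L ∷ Ls) = trans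
  (eval-⋀-∷ (everywhere 𝓤) (literal L) (map literal Ls))
  (trans (cong (_∧ eval (everywhere 𝓤) (conjunction Ls)) (undefined-literal L)) (absorb Ls))
  where
  undefined-literal : ∀ (L : Literal n) → eval (everywhere 𝓤) (literal L) ≡ 𝓤
  undefined-literal (pos _) = refl
  undefined-literal (neg _) = refl

  absorb : ∀ Ls → 𝓤 ∧ eval (everywhere 𝓤) (conjunction {n} Ls) ≡ 𝓤
  absorb Ls rewrite undefined-conjunction Ls with null Ls
  ... | true  = refl
  ... | false = refl

undefined-⋁ : ∀ (b : List (Literal n)) bs →
  eval (everywhere 𝓤) (⋁ (map conjunction (b ∷ bs))) ≡ (if any null (b ∷ bs) then 𝓣 else 𝓤)
undefined-⋁ b [] rewrite undefined-conjunction b with null b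
... | true  = refl
... | false = refl
undefined-⋁ b (b′ ∷ bs)
  rewrite undefined-conjunction b | undefined-⋁ b′ bs with null b | any null (b′ ∷ bs)
... | true  | _     = refl
... | false | true  = refl
... | false | false = refl

-- With all atoms undefined a nonempty body has value `𝓤`, so a disjunction of bodies is `𝓣` if one
-- of them is empty and `𝓤` otherwise.
facts≗Φ : ∀ (P : Datalog n) → facts (asProgram P) ≗ Φ P (everywhere 𝓤)
facts≗Φ P A with bodies P A
... | []     = refl
... | b ∷ bs = sym (trans (kleene-⋁ (λ _ ()) b bs) (undefined-⋁ b bs))

-- Founded sequences

-- Bit vectors serve twice: as termination measure for the founded sequence and as search space for
-- unfounded sets.
∈-tabulate : ∀ {V : Pred (Fin n) 0ℓ} (V? : Decidable V) → (_∈ˢ tabulate (does ∘ V?)) ≐ V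
∈-tabulate {V = V} V? = (λ {A} → ⁻ A) , λ {A} → ⁺ A
  where
  ⁻ : ∀ A → A ∈ˢ tabulate (does ∘ V?) → V A
  ⁻ A A∈ with V? A | trans (sym (lookup∘tabulate (does ∘ V?) A)) ([]=⇒lookup A∈)
  ... | yes v | _ = v
  ... | no _  | ()

  ⁺ : ∀ A → V A → A ∈ˢ tabulate (does ∘ V?)
  ⁺ A v = lookup⇒[]= A _ (trans (lookup∘tabulate _ A) (dec-true (V? A) v))

undefined : Interp n → Subset n
undefined I = tabulate λ A → does (I A ≟ 𝓤)

∈-undefined : ∀ {A} → A ∈ˢ undefined I ⇔ I A ≡ 𝓤
∈-undefined {I = I} = mk⇔ (proj₁ (∈-tabulate λ A → I A ≟ 𝓤)) (proj₂ (∈-tabulate λ A → I A ≟ 𝓤))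

-- An atom at which the two differ is undefined in `I` and defined in `J`; one is found by search,
-- equality of values being decidable.
undefined-⊂ : I ≼ J → ¬ (J ≗ I) → undefined J ⊂ undefined I
undefined-⊂ {n} {I} {J} I≼J J≢I
  with A , JA≢IA ← ¬∀⟶∃¬ n _ (λ A → J A ≟ I A) J≢I =
  (λ {B} B∈ → from (∈-undefined {I = I}) (still-undefined B (to (∈-undefined {I = J}) B∈))) ,
  A ,
  from (∈-undefined {I = I}) (decidable-stable (I A ≟ 𝓤) λ IA≢𝓤 → JA≢IA (sym (I≼J A IA≢𝓤))) ,
  λ A∈ → JA≢IA (trans (to (∈-undefined {I = J}) A∈)
                      (sym (still-undefined A (to (∈-undefined {I = J}) A∈))))
  where
  still-undefined : ∀ B → J B ≡ 𝓤 → I B ≡ 𝓤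
  still-undefined B JB≡𝓤 =
    decidable-stable (I B ≟ 𝓤) λ IB≢𝓤 → IB≢𝓤 (trans (I≼J B IB≢𝓤) JB≡𝓤)

-- As long as the stages change, the finite set of undefined atoms shrinks strictly.
stabilises : ∀ (F : ℕ → Interp n) → (∀ k → F k ≼ F (suc k)) → ∃ λ k → F (suc k) ≗ F k
stabilises F F≼ = from-stage 0 (⊂-wellFounded (undefined (F 0)))
  where
  from-stage : ∀ k → Acc _⊂_ (undefined (F k)) → ∃ λ k → F (suc k) ≗ F k
  from-stage k (acc rs) with Fin.all? (λ A → F (suc k) A ≟ F k A)
  ... | yes e = k , e
  ... | no ¬e = from-stage (suc k) (rs (undefined-⊂ (F≼ k) ¬e))

isLimit-unique : ∀ {F G : ℕ → Interp n} → (∀ k → F k ≗ G k) → IsLimit F I → IsLimit G J → I ≗ J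
isLimit-unique F≗G F→I G→J = ≼-antisym
  (F→I .least _ λ k → ≼-trans (≼-reflexive (F≗G k)) (G→J .upper k))
  (G→J .least _ λ k → ≼-trans (≼-reflexive (≗-sym (F≗G k))) (F→I .upper k))
  where open IsLimit

isLimit-resp : ∀ {F : ℕ → Interp n} → I ≗ J → IsLimit F I → IsLimit F J
isLimit-resp I≗J F→I = record
  { increasing = increasing
  ; upper      = λ k → ≼-trans (upper k) (≼-reflexive I≗J)
  ; least      = λ S′ F≼S′ → ≼-trans (≼-reflexive (≗-sym I≗J)) (least S′ F≼S′)
  }
  where open IsLimit F→I

isSupport-unique : ∀ {R : List (Clause n)} {H s t} →
  IsSupport I R H s → IsSupport I R H t → s ≗ t
isSupport-unique s-supp t-supp = ≼-antisym
  (t-supp .greatest _ (s-supp .below) (s-supp .sound))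
  (s-supp .greatest _ (t-supp .below) (t-supp .sound))
  where open IsSupport

sound-resp : ∀ {R : List (Clause n)} {H} → I ≗ J → Sound I R H → Sound J R H
sound-resp {R = R} {H} I≗J H-sound = record
  { compatible = λ A JA≢𝓤 HA≢𝓤 →
      trans (sym (I≗J A)) (compatible A (JA≢𝓤 ∘ trans (sym (I≗J A))) HA≢𝓤)
  ; justified  = ≼-trans justified (≼-reflexive (T-cong R λ A → cong (_⊕ H A) (I≗J A)))
  }
  where open Sound H-sound

isSupport-resp : ∀ {R : List (Clause n)} {H s} → I ≗ J → IsSupport I R H s → IsSupport J R H s
isSupport-resp I≗J s-supp = record
  { below    = below
  ; sound    = sound-resp I≗J sound
  ; greatest = λ H′ H′≼H H′-sound → greatest H′ H′≼H (sound-resp (≗-sym I≗J) H′-sound)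
  }
  where open IsSupport s-supp

module _ {P : Program n} {H : Interp n} where

  -- The indices are independent so that it can both compare two sequences at one index and compare
  -- one sequence with itself after a repetition.
  step-cong : ∀ {F G} → IsFoundedSequence P H F → IsFoundedSequence P H G →
              ∀ j k → F j ≗ G k → F (suc j) ≗ G (suc k)
  step-cong F-seq G-seq j k Fj≗Gk A
    with s , s-supp , F≗ ← F-seq .IsFoundedSequence.step j
       | t , t-supp , G≗ ← G-seq .IsFoundedSequence.step k =
    trans (F≗ A) (trans
      (cong₂ _⊕_ (T-cong (rules P) Fj≗Gk A) (isSupport-unique (isSupport-resp Fj≗Gk s-supp) t-supp A))
      (sym (G≗ A)))

  sequence-unique : ∀ {F G} → IsFoundedSequence P H F → IsFoundedSequence P H G → ∀ k → F k ≗ G k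
  sequence-unique F-seq G-seq zero = ≗-trans (F-seq .start) (≗-sym (G-seq .start))
    where open IsFoundedSequence
  sequence-unique F-seq G-seq (suc k) = step-cong F-seq G-seq k k (sequence-unique F-seq G-seq k)

  founded-unique : IsFoundedSemantics P H I → IsFoundedSemantics P H J → I ≗ J
  founded-unique (F , F-seq , F→I) (G , G-seq , G→J) =
    isLimit-unique (sequence-unique F-seq G-seq) F→I G→J

  founded-resp : I ≗ J → IsFoundedSemantics P H I → IsFoundedSemantics P H J
  founded-resp I≗J (F , F-seq , F→I) = F , F-seq , isLimit-resp I≗J F→I

  -- Both the founded semantics and `X` determine their interpretation up to `≗` and respect `≗`, so
  -- one common witness gives the equivalence for every `S`.
  founded-⇔ : {X : Interp n → Set ℓ} →
    (∀ {I J} → I ≗ J → X I → X J) → (∀ {I J} → X I → X J → I ≗ J) →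
    (∃ λ S → IsFoundedSemantics P H S × X S) →
    (∃ λ S → IsFoundedSemantics P H S) × (∀ S → IsFoundedSemantics P H S ⇔ X S)
  founded-⇔ X-resp X-unique (S , S-founded , XS) = (S , S-founded) , λ S′ → mk⇔
    (λ S′-founded → X-resp (founded-unique S-founded S′-founded) XS)
    (λ XS′ → founded-resp (X-unique XS XS′) S-founded)

  module _ {F : ℕ → Interp n} (F-seq : IsFoundedSequence P H F)
           (F≼ : ∀ k → F k ≼ F (suc k)) where

    monotone : ∀ j k → F k ≼ F (j + k)
    monotone zero    k = λ _ _ → refl
    monotone (suc j) k = ≼-trans (monotone j k) (F≼ (j + k))

    constant : ∀ k → F (suc k) ≗ F k → ∀ j → F (j + k) ≗ F k
    constant k stable zero    = λ _ → refl
    constant k stable (suc j) =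
      ≗-trans (step-cong F-seq F-seq (j + k) k (constant k stable j)) stable

    stable-founded : ∀ k → F (suc k) ≗ F k → IsFoundedSemantics P H (F k)
    stable-founded k stable = F , F-seq , record
      { increasing = F≼
      -- `F j` lies below `F (j + k)`, which agrees with `F k`; no comparison of `j` with `k` is
      -- needed.
      ; upper      = λ j → ≼-trans
          (subst (λ m → F j ≼ F m) (+-comm k j) (monotone k j))
          (≼-reflexive (constant k stable j))
      ; least      = λ _ F≼S′ → F≼S′ k
      }

  module _ (next support : Interp n → Interp n) (Stage : Interp n → Set ℓ)
           (stage-facts : Stage (facts P))
           (stage-next  : ∀ {I} → Stage I → Stage (next I))
           (increasing  : ∀ {I} → Stage I → I ≼ next I)
           (isSupport   : ∀ {I} → Stage I → IsSupport I (rules P) H (support I))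
           (next≗       : ∀ {I} → Stage I → next I ≗ (T[ rules P ] I ⊕ᴵ support I)) where

    -- Serves both hypotheses: `Stage` is an invariant under which `next` computes one founded step
    -- and extends its argument, so iteration from the facts reaches a fixed stage.
    iterate : ∃ λ k → IsFoundedSemantics P H (fold (facts P) next k)
            × Stage (fold (facts P) next k)
            × next (fold (facts P) next k) ≗ fold (facts P) next k
    iterate = k , stable-founded sequence (increasing ∘ stage) k stable , stage k , stable
      where
      stage : ∀ k → Stage (fold (facts P) next k)
      stage zero    = stage-facts
      stage (suc k) = stage-next (stage k)

      sequence : IsFoundedSequence P H (fold (facts P) next)
      sequence = record
        { start = λ _ → refl
        ; step  = λ k → support _ , isSupport (stage k) , next≗ (stage k)
        }

      stabilised = stabilises (fold (facts P) next) (increasing ∘ stage)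
      k          = proj₁ stabilised
      stable     = proj₂ stabilised

-- The everywhere underdefined hypothesis

-- The hypothesis itself is sound because it claims nothing, hence it is its own support.
undefined-support : ∀ (I : Interp n) R → IsSupport I R (everywhere 𝓤) (everywhere 𝓤)
undefined-support I R = record
  { below    = λ _ _ → refl
  ; sound    = record
    { compatible = λ _ _ 𝓤≢𝓤 → contradiction refl 𝓤≢𝓤
    ; justified  = λ A /≢𝓤 → contradiction (restricted A) /≢𝓤
    }
  ; greatest = λ _ H′≼ _ → H′≼
  }
  where
  restricted : ∀ A → (everywhere 𝓤 / map head R) A ≡ 𝓤
  restricted A with A ∈ᵃ? map head R
  ... | yes _ = refl
  ... | no _  = refl

≼⇒≤ₖ : I ≼ J → ∀ A → I A ≤ₖ J A
≼⇒≤ₖ {I = I} I≼J A with I A ≟ 𝓤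
... | yes IA≡𝓤 = inj₁ IA≡𝓤
... | no IA≢𝓤  = inj₂ (inj₁ (I≼J A IA≢𝓤))

isKripkeKleene-unique : ∀ {P : Datalog n} → IsKripkeKleene P I → IsKripkeKleene P J → I ≗ J
isKripkeKleene-unique I-kk J-kk A = IsLattice.antisym knowledge-isLattice
  (I-kk .least _ (J-kk .three-valued) (J-kk .fixpoint) A)
  (J-kk .least _ (I-kk .three-valued) (I-kk .fixpoint) A)
  where open IsKripkeKleene

isKripkeKleene-resp : ∀ {P : Datalog n} → I ≗ J → IsKripkeKleene P I → IsKripkeKleene P J
isKripkeKleene-resp {P = P} I≗J I-kk = record
  { three-valued = λ A → three-valued A ∘ trans (I≗J A)
  ; iterated     = proj₁ iterated , ≗-trans (≗-sym I≗J) (proj₂ iterated)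
  ; fixpoint     = ≗-trans (≗-sym (Φ-cong P three-valued I≗J)) (≗-trans fixpoint I≗J)
  ; least        = λ v v₃ v-fix A → subst (_≤ₖ v A) (I≗J A) (least v v₃ v-fix A)
  }
  where open IsKripkeKleene I-kk

module KripkeKleene (P : Datalog n) where

  Stage : Interp n → Set
  Stage I = ThreeValued I × I ≼ Φ P I

  stage-Φ : ∀ {I} → Stage I → Stage (Φ P I)
  stage-Φ (I₃ , I≼) = Φ-≢𝓞 P I₃ , Φ-≼ P I₃ (Φ-≢𝓞 P I₃) I≼

  stage-facts : Stage (facts (asProgram P))
  stage-facts =
    (λ A → Φ-≢𝓞 P (λ _ ()) A ∘ trans (sym (facts≗Φ P A))) ,
    -- The everywhere undefined interpretation is a stage, hence so is its image under `Φ`; this is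
    -- carried over along `facts≗Φ`.
    ≼-trans (≼-reflexive (facts≗Φ P))
      (≼-trans (proj₂ (stage-Φ ((λ _ ()) , λ _ 𝓤≢𝓤 → contradiction refl 𝓤≢𝓤)))
        (≼-reflexive (Φ-cong P (Φ-≢𝓞 P (λ _ ())) (≗-sym (facts≗Φ P)))))

  fold-𝓤-≢𝓞 : ∀ k → ThreeValued (fold (everywhere 𝓤) (Φ P) k)
  fold-𝓤-≢𝓞 zero    = λ _ ()
  fold-𝓤-≢𝓞 (suc k) = Φ-≢𝓞 P (fold-𝓤-≢𝓞 k)

  -- The shift by one arises because the facts are already the first iterate of `Φ`.
  fold-shift : ∀ k → fold (facts (asProgram P)) (Φ P) k ≗ fold (everywhere 𝓤) (Φ P) (suc k)
  fold-shift zero    = facts≗Φ P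
  fold-shift (suc k) = ≗-sym (Φ-cong P (fold-𝓤-≢𝓞 (suc k)) (≗-sym (fold-shift k)))

  -- Supplies leastness: monotonicity of `Φ` keeps every iterate below any three-valued fixpoint.
  fold-below : ∀ {v} → ThreeValued v → Φ P v ≗ v → ∀ k → fold (everywhere 𝓤) (Φ P) k ≼ v
  fold-below v₃ v-fix zero    = λ _ 𝓤≢𝓤 → contradiction refl 𝓤≢𝓤
  fold-below v₃ v-fix (suc k) =
    ≼-trans (Φ-≼ P (fold-𝓤-≢𝓞 k) v₃ (fold-below v₃ v-fix k)) (≼-reflexive v-fix)

  founded : ∃ λ S → IsFoundedSemantics (asProgram P) (everywhere 𝓤) S × IsKripkeKleene P S
  founded with k , S-founded , (S₃ , _) , stable ←
    iterate (Φ P) (λ _ → everywhere 𝓤) Stage stage-facts stage-Φ proj₂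
      (λ _ → undefined-support _ _)
      (λ (I₃ , _) A → trans (sym (T≗Φ P I₃ A)) (sym (⊕-identityʳ _)))
    = fold (facts (asProgram P)) (Φ P) k , S-founded , record
    { three-valued = S₃
    ; iterated     = suc k , fold-shift k
    ; fixpoint     = stable
    ; least        = λ v v₃ v-fix → ≼⇒≤ₖ
        (≼-trans (≼-reflexive (fold-shift k)) (fold-below v₃ v-fix (suc k)))
    }

-- The everywhere false hypothesis

infix 4 _⊑_
_⊑_ : (K L : PartialInterp n) → Set
K ⊑ L = literals K ⊆′ literals L

toPartial-≼ : I ≼ J → toPartial I ⊑ toPartial J
toPartial-≼ I≼J {pos A} IA≡𝓣 =
  trans (sym (I≼J A λ IA≡𝓤 → contradiction (trans (sym IA≡𝓣) IA≡𝓤) λ ())) IA≡𝓣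
toPartial-≼ I≼J {neg A} IA≡𝓕 =
  trans (sym (I≼J A λ IA≡𝓤 → contradiction (trans (sym IA≡𝓕) IA≡𝓤) λ ())) IA≡𝓕

-- `toPartial` yields no literal for `𝓞`, just as for `𝓤`, hence the assumption on `I`.
toPartial-≼⁻ : ThreeValued I → toPartial I ⊑ toPartial J → I ≼ J
toPartial-≼⁻ {I = I} I₃ I⊑J A IA≢𝓤 with I A in e
... | 𝓕 = sym (I⊑J {neg A} e)
... | 𝓣 = sym (I⊑J {pos A} e)
... | 𝓤 = contradiction refl IA≢𝓤
... | 𝓞 = contradiction e (I₃ A)

consistent-literal : ∀ (K : PartialInterp n) L → literals K L → ¬ literals K (complement L)
consistent-literal K (pos A) t f = consistent K A (t , f)
consistent-literal K (neg A) f t = consistent K A (t , f)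

literal? : ∀ (I : Interp n) L → Dec (literals (toPartial I) L)
literal? I (pos A) = I A ≟ 𝓣
literal? I (neg A) = I A ≟ 𝓕

module _ {P : Datalog n} where

  consequences-⊑ : ∀ {K L : PartialInterp n} → K ⊑ L → Consequences P K ⊆′ Consequences P L
  consequences-⊑ K⊑L = Any.map λ (h , ls) → h , All.map K⊑L ls

  unfounded-⊑ : ∀ {K L : PartialInterp n} {U} → K ⊑ L → Unfounded P K U → Unfounded P L U
  unfounded-⊑ K⊑L U-unf UA r∈P h = Any.map (λ {L} → Sum.map₁ (K⊑L {complement L})) (U-unf UA r∈P h)

  unfounded-≐ : ∀ {K : PartialInterp n} {U V} → U ≐ V → Unfounded P K U → Unfounded P K V
  unfounded-≐ (U⊆V , V⊆U) U-unf VA r∈P h =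
    Any.map (Sum.map₂ λ (B , e , UB) → B , e , U⊆V UB) (U-unf (V⊆U VA) r∈P h)

  W-resp : ∀ {K K′ L L′ : PartialInterp n} → literals K ≐ literals K′ → literals L ≐ literals L′ →
           W P K L → W P K′ L′
  W-resp {K} {K′} {L} {L′} (K⊑K′ , K′⊑K) (L⊑L′ , L′⊑L) (U , U-gu , L⊆ , ⊆L) =
    U ,
    record
      { unfounded = unfounded-⊑ {K} {K′} K⊑K′ unfounded
      ; greatest  = λ V V-unf → greatest V (unfounded-⊑ {K′} {K} K′⊑K V-unf)
      } ,
    (λ {l} → ⊆₁ {l}) , λ {l} → ⊆₂ {l}
    where
    open IsGreatestUnfounded U-gu

    ⊆₁ : literals L′ ⊆′ (Consequences P K′ ∪¬ U)
    ⊆₁ {pos A} l = consequences-⊑ {K} {K′} K⊑K′ (L⊆ {pos A} (L′⊑L l))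
    ⊆₁ {neg A} l = L⊆ {neg A} (L′⊑L l)

    ⊆₂ : (Consequences P K′ ∪¬ U) ⊆′ literals L′
    ⊆₂ {pos A} c = L⊑L′ (⊆L {pos A} (consequences-⊑ {K′} {K} K′⊑K c))
    ⊆₂ {neg A} u = L⊑L′ (⊆L {neg A} u)

  -- The greatest unfounded set for `K` stays unfounded for the larger `K′`, hence lies in the
  -- greatest one there.
  W-mono : ∀ {K K′ L L′ : PartialInterp n} → K ⊑ K′ → W P K L → W P K′ L′ → L ⊑ L′
  W-mono {K} {K′} K⊑K′ (U , U-gu , L⊆ , _) (U′ , U′-gu , _ , ⊆L′) {pos A} l =
    ⊆L′ {pos A} (consequences-⊑ {K} {K′} K⊑K′ (L⊆ {pos A} l))
  W-mono {K} {K′} K⊑K′ (U , U-gu , L⊆ , _) (U′ , U′-gu , _ , ⊆L′) {neg A} l =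
    ⊆L′ {neg A} (U′-gu .greatest U (unfounded-⊑ {K} {K′} K⊑K′ (U-gu .unfounded)) (L⊆ {neg A} l))
    where open IsGreatestUnfounded

isWellFounded-unique : ∀ {P : Datalog n} → IsWellFounded P I → IsWellFounded P J → I ≗ J
isWellFounded-unique (I₃ , I-lfp) (J₃ , J-lfp) = ≼-antisym
  (toPartial-≼⁻ I₃ (I-lfp .least _ (J-lfp .fixpoint)))
  (toPartial-≼⁻ J₃ (J-lfp .least _ (I-lfp .fixpoint)))
  where open IsLeastFixpointW

isWellFounded-resp : ∀ {P : Datalog n} → I ≗ J → IsWellFounded P I → IsWellFounded P J
isWellFounded-resp {I = I} {J} {P} I≗J (I₃ , I-lfp) =
  (λ A → I₃ A ∘ trans (I≗J A)) , record
    { fixpoint = W-resp {K = toPartial I} {toPartial J} {toPartial I} {toPartial J} same same fixpoint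
    ; least    = λ K K-fix {L} → least K K-fix {L} ∘ proj₂ same {L}
    }
  where
  open IsLeastFixpointW I-lfp

  same : literals (toPartial I) ≐ literals (toPartial J)
  same = (λ {L} → toPartial-≼ (≼-reflexive I≗J) {L}) , λ {L} → toPartial-≼ (≼-reflexive (≗-sym I≗J)) {L}

-- Excluded middle holds up to double negation at each atom, and over finitely many atoms the double
-- negation moves outside.
¬¬-decidable : (V : Pred (Fin n) 0ℓ) → ¬ ¬ Decidable V
¬¬-decidable V = Fin.sequence (RawMonad.rawApplicative ¬¬-Monad) λ _ → ¬¬-excluded-middle


-- Sums of compatible interpretations

≼-⊕ˡ : Compatible I J → I ≼ (I ⊕ᴵ J)
≼-⊕ˡ {I = I} {J} compat A IA≢𝓤 with J A ≟ 𝓤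
... | yes JA≡𝓤 = sym (trans (cong (I A ⊕_) JA≡𝓤) (⊕-identityʳ (I A)))
... | no JA≢𝓤  = sym (trans (cong (I A ⊕_) (sym (compat A IA≢𝓤 JA≢𝓤))) (⊕-idem (I A)))

≼-⊕ʳ : Compatible I J → J ≼ (I ⊕ᴵ J)
≼-⊕ʳ {I = I} {J} compat A JA≢𝓤 = trans
  (≼-⊕ˡ (λ B JB≢𝓤 IB≢𝓤 → sym (compat B IB≢𝓤 JB≢𝓤)) A JA≢𝓤)
  (⊕-comm (J A) (I A))

⊕-≢𝓞 : Compatible I J → ThreeValued I → ThreeValued J → ThreeValued (I ⊕ᴵ J)
⊕-≢𝓞 {I = I} {J} compat I₃ J₃ A e with I A ≟ 𝓤
... | yes IA≡𝓤 = J₃ A (trans (cong (_⊕ J A) (sym IA≡𝓤)) e)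
... | no IA≢𝓤  = I₃ A (trans (≼-⊕ˡ compat A IA≢𝓤) e)

restrict-∈ : ∀ (H : Interp n) {S A} → A ∈ S → (H / S) A ≡ H A
restrict-∈ H {S} {A} A∈ with A ∈ᵃ? S
... | yes _ = refl
... | no A∉ = contradiction A∈ A∉

restrict-∉ : ∀ (H : Interp n) {S A} → A ∉ S → (H / S) A ≡ 𝓤
restrict-∉ H {S} {A} A∉ with A ∈ᵃ? S
... | yes A∈ = contradiction A∈ A∉
... | no _   = refl

≼𝓕⇒≢ : I ≼ everywhere 𝓕 → ∀ {α} → α ≢ 𝓤 → α ≢ 𝓕 → ∀ A → I A ≢ α
≼𝓕⇒≢ I≼𝓕 α≢𝓤 α≢𝓕 A IA≡α =
  α≢𝓕 (trans (sym IA≡α) (I≼𝓕 A λ IA≡𝓤 → α≢𝓤 (trans (sym IA≡α) IA≡𝓤)))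

-- Sound false hypotheses and unfounded sets

FalseIn : Interp n → Pred (Atom n) 0ℓ
FalseIn H A = H A ≡ 𝓕

module _ (P : Datalog n) {I H : Interp n} (I₃ : ThreeValued I) (H≼ : H ≼ everywhere 𝓕)
         (compat : Compatible I H) where

  private
    K : Interp n
    K = I ⊕ᴵ H

    K₃ : ThreeValued K
    K₃ = ⊕-≢𝓞 compat I₃ (≼𝓕⇒≢ H≼ (λ ()) λ ())

    -- The two ways in which `K` can falsify a literal are the two alternatives of `Unfounded`. A
    -- negative literal is falsified through `I` only, as `H` is never `𝓣`.
    split : ∀ L → literals (toPartial K) (complement L) →
            literals (toPartial I) (complement L) ⊎ Positively (FalseIn H) L
    split (pos A) e with ⊕-sel {I A} {H A} (K₃ A)
    ... | inj₁ K≡I = inj₁ (trans (sym K≡I) e)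
    ... | inj₂ K≡H = inj₂ (A , refl , trans (sym K≡H) e)
    split (neg A) e with ⊕-sel {I A} {H A} (K₃ A)
    ... | inj₁ K≡I = inj₁ (trans (sym K≡I) e)
    ... | inj₂ K≡H = contradiction (trans (sym K≡H) e) (≼𝓕⇒≢ H≼ (λ ()) (λ ()) A)

    unsplit : ∀ L → literals (toPartial I) (complement L) ⊎ Positively (FalseIn H) L →
              literals (toPartial K) (complement L)
    unsplit L (inj₁ l) = toPartial-≼ (≼-⊕ˡ compat) {complement L} l
    unsplit L (inj₂ (A , refl , HA≡𝓕)) = toPartial-≼ (≼-⊕ʳ compat) {neg A} HA≡𝓕

  -- A rule for `A` makes `A` a head, so justification forces `Φ P K A` to be `𝓕`; every body then
  -- has a failing literal, to which `split` applies.
  sound⇒unfounded : Sound I (rules (asProgram P)) H → Unfounded P (toPartial I) (FalseIn H)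
  sound⇒unfounded H-sound {A} HA≡𝓕 {r} r∈P refl =
    Any.map (λ {L} → split L) (proj₂ (to (Φ-𝓕 P K₃) ΦA≡𝓕) r∈P refl)
    where
    restricted : (H / map head (rules (asProgram P))) A ≡ 𝓕
    restricted = trans (restrict-∈ H (from (∈-rules {P = P}) (∈-map⁺ head r∈P))) HA≡𝓕

    ΦA≡𝓕 : Φ P K A ≡ 𝓕
    ΦA≡𝓕 = trans (sym (T≗Φ P K₃ A)) (trans
      (sym (H-sound .Sound.justified A λ e → contradiction (trans (sym restricted) e) λ ()))
      restricted)

  unfounded⇒sound : Unfounded P (toPartial I) (FalseIn H) → Sound I (rules (asProgram P)) H
  unfounded⇒sound H-unf = record { compatible = compat ; justified = justified }
    where
    justified : (H / map head (rules (asProgram P))) ≼ T[ rules (asProgram P) ] K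
    justified A /≢𝓤 with A ∈ᵃ? Heads P
    -- The restriction exempts atoms without rules from justification.
    ... | no A∉ = contradiction (restrict-∉ H (A∉ ∘ to (∈-rules {P = P}))) /≢𝓤
    ... | yes A∈ = trans restricted (trans HA≡𝓕 (sym (trans (T≗Φ P K₃ A)
        (from (Φ-𝓕 P K₃) (A∈ , λ r∈P h → Any.map (λ {L} → unsplit L) (H-unf HA≡𝓕 r∈P h))))))
      where
      restricted : (H / map head (rules (asProgram P))) A ≡ H A
      restricted = restrict-∈ H (from (∈-rules {P = P}) A∈)

      HA≡𝓕 : H A ≡ 𝓕
      HA≡𝓕 = H≼ A (/≢𝓤 ∘ trans restricted)

-- Greatest unfounded sets and the founded steps

module WellFounded (P : Datalog n) where

  positively? : ∀ (V : Subset n) L → Dec (Positively (_∈ˢ V) L)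
  positively? V (pos A) = map′ (λ A∈ → A , refl , A∈) (λ { (_ , refl , A∈) → A∈ }) (A ∈ˢ? V)
  positively? V (neg A) = no λ { (_ , () , _) }

  unfounded? : ∀ I (V : Subset n) → Dec (Unfounded P (toPartial I) (_∈ˢ V))
  unfounded? I V = map′
    (λ unf {A} A∈ {r} r∈P h → All.lookup unf r∈P (subst (_∈ˢ V) (sym h) A∈))
    (λ unf → All.tabulate λ r∈P hr∈ → unf hr∈ r∈P refl)
    (All.all? (λ r → head r ∈ˢ? V →-dec
      Any.any? (λ L → literal? I (complement L) ⊎-dec positively? V L) (body r)) P)

  -- The union of the unfounded sets given as bit vectors. Arbitrary predicates would raise the
  -- universe level and could not be searched.
  GreatestUnfounded : Interp n → Pred (Atom n) 0ℓ
  GreatestUnfounded I A = ∃ λ V → Unfounded P (toPartial I) (_∈ˢ V) × A ∈ˢ V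

  greatestUnfounded? : ∀ I → Decidable (GreatestUnfounded I)
  greatestUnfounded? I A = anySubset? λ V → unfounded? I V ×-dec A ∈ˢ? V

  -- An arbitrary predicate V is decidable only up to double negation, which
  -- suffices because membership in GreatestUnfounded is stable.
  isGreatestUnfounded : ∀ I → IsGreatestUnfounded P (toPartial I) (GreatestUnfounded I)
  isGreatestUnfounded I = record
    { unfounded = λ (V , V-unf , A∈) r∈P h →
        Any.map (Sum.map₂ λ (B , e , B∈) → B , e , V , (λ {A} → V-unf {A}) , B∈) (V-unf A∈ r∈P h)
    ; greatest  = λ V V-unf {A} VA → decidable-stable (greatestUnfounded? I A) λ ¬gu →
        ¬¬-decidable V λ V? → ¬gu
          ( tabulate (does ∘ V?)
          , unfounded-≐ {K = toPartial I} (proj₂ (∈-tabulate V?) , proj₁ (∈-tabulate V?)) V-unf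
          , proj₂ (∈-tabulate V?) VA )
    }

  module GU I = IsGreatestUnfounded (isGreatestUnfounded I)

  support : Interp n → Interp n
  support I A = if does (greatestUnfounded? I A) then 𝓕 else 𝓤

  support-𝓕 : ∀ I {A} → support I A ≡ 𝓕 ⇔ GreatestUnfounded I A
  support-𝓕 I {A} with greatestUnfounded? I A
  ... | yes gu = mk⇔ (λ _ → gu) (λ _ → refl)
  ... | no ¬gu = mk⇔ (λ ()) (λ gu → contradiction gu ¬gu)

  support≼ : ∀ I → support I ≼ everywhere 𝓕
  support≼ I A s≢𝓤 with greatestUnfounded? I A
  ... | yes _ = refl
  ... | no _  = contradiction refl s≢𝓤

  next : Interp n → Interp n
  next I = Φ P I ⊕ᴵ support I

  -- Quantifying over all extensions `J` lets the property pass to later stages, where more literals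
  -- are decided.
  Avoiding : Interp n → Set₁
  Avoiding I = ∀ J → I ≼ J → ∀ U → Unfounded P (toPartial J) U → ∀ {A} → I A ≡ 𝓣 → ¬ U A

  -- The body of the deriving rule is true in `I`. Unfoundedness would either falsify one of its
  -- literals in `J`, against consistency, or put a true atom of `I` into `U`.
  consequence-avoids : Avoiding I → I ≼ J → ∀ {U} → Unfounded P (toPartial J) U →
                       ∀ {A} → Consequences P (toPartial I) A → ¬ U A
  consequence-avoids {I} {J} av I≼J {U} U-unf c UA
    with r , r∈P , refl , ls ← find c
    with L , L∈ , l ← find (U-unf UA r∈P refl) | l
  ... | inj₁ ¬L = consistent-literal (toPartial J) L (toPartial-≼ I≼J {L} (All.lookup ls L∈)) ¬L
  ... | inj₂ (B , refl , UB) = av J I≼J U U-unf (All.lookup ls L∈) UB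

  avoiding-consequences : Avoiding I → I ≼ J →
    (∀ {A} → J A ≡ 𝓣 → Consequences P (toPartial I) A) → Avoiding J
  avoiding-consequences av I≼J J-cons K J≼K U U-unf JA≡𝓣 =
    consequence-avoids av (≼-trans I≼J J≼K) U-unf (J-cons JA≡𝓣)

  Φ-𝓕⇒unfounded : ThreeValued I → ∀ {A} → Φ P I A ≡ 𝓕 → GreatestUnfounded I A
  Φ-𝓕⇒unfounded {I} I₃ {A} e = GU.greatest I (A ≡_)
    (λ { refl r∈P h → Any.map inj₁ (proj₂ (to (Φ-𝓕 P I₃) e) r∈P h) }) refl

  support-compatible : ThreeValued J → (∀ {A} → J A ≡ 𝓣 → ¬ GreatestUnfounded I A) →
                       Compatible J (support I)
  support-compatible {J} {I} J₃ disjoint A JA≢𝓤 s≢𝓤 with J A in e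
  ... | 𝓕 = sym (support≼ I A s≢𝓤)
  ... | 𝓣 = contradiction (to (support-𝓕 I) (support≼ I A s≢𝓤)) (disjoint e)
  ... | 𝓤 = contradiction refl JA≢𝓤
  ... | 𝓞 = contradiction e (J₃ A)

  module _ {I : Interp n} (I₃ : ThreeValued I) (av : Avoiding I) where

    compatible : Compatible I (support I)
    compatible = support-compatible I₃ λ e gu →
      av I (λ _ _ → refl) _ (λ {A} → GU.unfounded I {A}) e gu

    -- Sound hypotheses below `everywhere 𝓕` correspond to unfounded sets, so the greatest ones
    -- correspond too.
    isSupport : IsSupport I (rules (asProgram P)) (everywhere 𝓕) (support I)
    isSupport = record
      { below    = support≼ I
      ; sound    = unfounded⇒sound P I₃ (support≼ I) compatible
          (unfounded-≐ {K = toPartial I} (from (support-𝓕 I) , to (support-𝓕 I)) (GU.unfounded I))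
      ; greatest = λ H H≼ H-sound A HA≢𝓤 → trans (H≼ A HA≢𝓤) (sym (from (support-𝓕 I)
          (GU.greatest I (FalseIn H)
            (sound⇒unfounded P I₃ H≼ (H-sound .Sound.compatible) H-sound)
            (H≼ A HA≢𝓤))))
      }

    Φ-compatible : Compatible (Φ P I) (support I)
    Φ-compatible = support-compatible (Φ-≢𝓞 P I₃) λ e →
      consequence-avoids av (λ _ _ → refl) (GU.unfounded I) (to (Φ-𝓣 P I₃) e)

    Φ≼next : Φ P I ≼ next I
    Φ≼next = ≼-⊕ˡ Φ-compatible

    next-≢𝓞 : ThreeValued (next I)
    next-≢𝓞 = ⊕-≢𝓞 Φ-compatible (Φ-≢𝓞 P I₃) (≼𝓕⇒≢ (support≼ I) (λ ()) λ ())

    next-𝓣 : ∀ A → next I A ≡ 𝓣 ⇔ Consequences P (toPartial I) A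
    next-𝓣 A = mk⇔ ⁻ λ c → toPartial-≼ Φ≼next {pos A} (from (Φ-𝓣 P I₃) c)
      where
      ⁻ : next I A ≡ 𝓣 → Consequences P (toPartial I) A
      ⁻ e with ⊕-sel {Φ P I A} {support I A} (next-≢𝓞 A)
      ... | inj₁ next≡Φ = to (Φ-𝓣 P I₃) (trans (sym next≡Φ) e)
      ... | inj₂ next≡s = contradiction (trans (sym next≡s) e) (≼𝓕⇒≢ (support≼ I) (λ ()) (λ ()) A)

    -- A false value may also come from `Φ`; by `Φ-𝓕⇒unfounded` it adds no atom to the greatest
    -- unfounded set.
    next-𝓕 : ∀ A → next I A ≡ 𝓕 ⇔ GreatestUnfounded I A
    next-𝓕 A = mk⇔ ⁻ λ gu → toPartial-≼ (≼-⊕ʳ Φ-compatible) {neg A} (from (support-𝓕 I) gu)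
      where
      ⁻ : next I A ≡ 𝓕 → GreatestUnfounded I A
      ⁻ e with ⊕-sel {Φ P I A} {support I A} (next-≢𝓞 A)
      ... | inj₁ next≡Φ = Φ-𝓕⇒unfounded I₃ (trans (sym next≡Φ) e)
      ... | inj₂ next≡s = to (support-𝓕 I) (trans (sym next≡s) e)

    W-next : W P (toPartial I) (toPartial (next I))
    W-next = GreatestUnfounded I , isGreatestUnfounded I , (λ {L} → ⁻ L) , λ {L} → ⁺ L
      where
      ⁻ : ∀ L → literals (toPartial (next I)) L → (Consequences P (toPartial I) ∪¬ GreatestUnfounded I) L
      ⁻ (pos A) = to (next-𝓣 A)
      ⁻ (neg A) = to (next-𝓕 A)

      ⁺ : ∀ L → (Consequences P (toPartial I) ∪¬ GreatestUnfounded I) L → literals (toPartial (next I)) L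
      ⁺ (pos A) = from (next-𝓣 A)
      ⁺ (neg A) = from (next-𝓕 A)

  -- `avoiding` keeps `𝓞` out, `increasing` makes the iteration stabilise, and `below` becomes
  -- leastness of the limit.
  record Stage (I : Interp n) : Set₁ where
    field
      three-valued : ThreeValued I
      avoiding     : Avoiding I
      increasing   : I ≼ next I
      below        : ∀ K → W P K K → toPartial I ⊑ K
  open Stage

  stage-next : Stage I → Stage (next I)
  stage-next {I} st = record
    { three-valued = next₃
    ; avoiding     = next-av
    -- Monotonicity of `W` carries `I ≼ next I` one step further.
    ; increasing   = toPartial-≼⁻ next₃
        (W-mono {K = toPartial I} {toPartial (next I)} {toPartial (next I)} {toPartial (next (next I))}
          (λ {L} → toPartial-≼ (st .increasing) {L}) W-I (W-next next₃ next-av))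
    ; below        = λ K K-fix →
        W-mono {K = toPartial I} {K} {toPartial (next I)} {K} (st .below K K-fix) W-I K-fix
    }
    where
    next₃ = next-≢𝓞 (st .three-valued) (st .avoiding)
    W-I   = W-next (st .three-valued) (st .avoiding)

    next-av : Avoiding (next I)
    next-av = avoiding-consequences (st .avoiding) (st .increasing)
      (λ {A} → to (next-𝓣 (st .three-valued) (st .avoiding) A))

  -- The facts are only the `Φ` part of the first `W` step from the undefined interpretation, whose
  -- unfounded atoms are missing. Lying below that step suffices for `below`.
  stage-facts : Stage (facts (asProgram P))
  stage-facts = record
    { three-valued = facts₃
    ; avoiding     = facts-av
    ; increasing   = ≼-trans (≼-reflexive (facts≗Φ P))
        (≼-trans (Φ-≼ P 𝓤₃ facts₃ 𝓤≼) (Φ≼next facts₃ facts-av))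
    ; below        = λ K K-fix {L} l →
        W-mono {K = toPartial 𝓤ᴵ} {K} {toPartial (next 𝓤ᴵ)} {K}
          (λ {L} → 𝓤⊑ K {L}) (W-next 𝓤₃ 𝓤-av) K-fix {L}
          (toPartial-≼ (≼-trans (≼-reflexive (facts≗Φ P)) (Φ≼next 𝓤₃ 𝓤-av)) {L} l)
    }
    where
    𝓤ᴵ : Interp n
    𝓤ᴵ = everywhere 𝓤

    𝓤₃ : ThreeValued 𝓤ᴵ
    𝓤₃ _ ()

    𝓤-av : Avoiding 𝓤ᴵ
    𝓤-av _ _ _ _ ()

    𝓤≼ : 𝓤ᴵ ≼ J
    𝓤≼ _ 𝓤≢𝓤 = contradiction refl 𝓤≢𝓤

    𝓤⊑ : ∀ K → toPartial 𝓤ᴵ ⊑ K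
    𝓤⊑ K {pos _} ()
    𝓤⊑ K {neg _} ()

    facts₃ : ThreeValued (facts (asProgram P))
    facts₃ A = Φ-≢𝓞 P 𝓤₃ A ∘ trans (sym (facts≗Φ P A))

    facts-av : Avoiding (facts (asProgram P))
    facts-av = avoiding-consequences 𝓤-av 𝓤≼ λ {A} e →
      to (Φ-𝓣 P 𝓤₃) (trans (sym (facts≗Φ P A)) e)

  founded : ∃ λ S → IsFoundedSemantics (asProgram P) (everywhere 𝓕) S × IsWellFounded P S
  founded with k , S-founded , st , stable ←
    iterate next support Stage stage-facts stage-next increasing
      (λ st → isSupport (st .three-valued) (st .avoiding))
      (λ {I} st A → cong (_⊕ support I A) (sym (T≗Φ P (st .three-valued) A)))
    = S , S-founded , st .three-valued , record
    -- At the stable stage `next S` agrees with `S`, so the step of `W` leads from `S` to itself.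
    { fixpoint = W-resp {K = toPartial S} {toPartial S} {toPartial (next S)} {toPartial S}
        ((λ l → l) , λ l → l)
        ((λ {L} → toPartial-≼ (≼-reflexive stable) {L}) ,
          λ {L} → toPartial-≼ (≼-reflexive (≗-sym stable)) {L})
        (W-next (st .three-valued) (st .avoiding))
    ; least    = st .below
    }
    where
    S = fold (facts (asProgram P)) next k

theorem2 : ∀ {n : ℕ} (P : Datalog n) →
    ((∃ λ S → IsFoundedSemantics (asProgram P) (everywhere 𝓕) S)
    × (∀ S → IsFoundedSemantics (asProgram P) (everywhere 𝓕) S ⇔ IsWellFounded P S))
    ×
    ((∃ λ S → IsFoundedSemantics (asProgram P) (everywhere 𝓤) S)
    × (∀ S → IsFoundedSemantics (asProgram P) (everywhere 𝓤) S ⇔ IsKripkeKleene P S))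
theorem2 P =
  founded-⇔ isWellFounded-resp isWellFounded-unique (WellFounded.founded P) ,
  founded-⇔ isKripkeKleene-resp isKripkeKleene-unique (KripkeKleene.founded P)
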